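{- Let $F$ be a finite simple graph with maximum degree $\Delta \geq 1$, and let $G$ be a $k$-fold cover of $F$. Then $\gamma(G) \geq \frac{1}{H(\Delta)}\,k\,\gamma(F)$, where $H(\Delta) = 1 + \frac{1}{2} + \frac{1}{3} + \cdots + \frac{1}{\Delta}$.
   Context: All graphs are finite, simple and undirected. A graph $G$ is a cover of a graph $F$ if there is an onto map $\pi: V(G)\to V(F)$ such that for every vertex $v$ of $G$, $\pi$ maps the neighbours of $v$ in $G$ bijectively onto the neighbours of $\pi(v)$ in $F$; the cover is $k$-fold if every fibre $\pi^{ -1}(u)$ has exactly $k$ vertices. (Degrees are preserved by $\pi$, so $G$ and $F$ have the same maximum degree $\Delta$.) $\gamma(\cdot)$ denotes the domination number: the minimum size of a set $S$ of vertices such that every vertex not in $S$ has a neighbour in $S$. -}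

module Defs where

open import Data.Fin.Base using (Fin)
open import Data.Fin.Properties using (_≟_; all?; any?)
open import Data.Fin.Subset using (Subset; _∈_; _∉_; ∣_∣; ⊤)
open import Data.Fin.Subset.Properties using (_∈?_; ∈⊤; anySubset?)
open import Data.Integer.Base using (+_)
open import Data.List.Base using (map; allFin)
open import Data.List.Extrema.Nat using (max)
open import Data.Nat.Base as ℕ using (ℕ; zero; suc; z≤n; s≤s)
import Data.Nat.Properties as ℕ
open import Data.Product.Base using (∃; _×_; _,_; proj₁; proj₂)
open import Data.Rational.Base as ℚ using (ℚ; 0ℚ; _/_)
import Data.Rational.Properties as ℚ
open import Data.Vec.Base using (tabulate)
open import Function.Base using (_∘_)
open import Function.Definitions using (Surjective)
open import Level using (0ℓ)
open import Relation.Binary.Core using (Rel)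
open import Relation.Binary.Definitions as Binary using (Symmetric; Irreflexive)
open import Relation.Binary.PropositionalEquality using (_≡_; refl)
open import Relation.Nullary.Decidable using (does; yes; no; ¬?; _×-dec_; _→-dec_)
open import Relation.Nullary.Negation using (contradiction)
open import Relation.Unary using (Pred; Decidable)

record Graph : Set₁ where
  field
    order  : ℕ
    Adj    : Rel (Fin order) 0ℓ
    adj?   : Binary.Decidable Adj
    sym    : Symmetric Adj
    irrefl : Irreflexive _≡_ Adj

  Vertex : Set
  Vertex = Fin order

open Graph public using (Vertex)

module _ (G : Graph) where
  open Graph G using (order; Adj; adj?)

  neighbours : Vertex G → Subset order
  neighbours v = tabulate (λ w → does (adj? v w))

  degree : Vertex G → ℕ
  degree v = ∣ neighbours v ∣

  -- The graph without vertices gets maximum degree 0.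
  maxDegree : ℕ
  maxDegree = max 0 (map degree (allFin order))

  Dominating : Pred (Subset order) 0ℓ
  Dominating S = ∀ v → v ∉ S → ∃ λ w → w ∈ S × Adj v w

  dominating? : Decidable Dominating
  dominating? S =
    all? λ v → ¬? (v ∈? S) →-dec any? λ w → (w ∈? S) ×-dec adj? v w

  DominatingSize : Pred ℕ 0ℓ
  DominatingSize m = ∃ λ S → Dominating S × ∣ S ∣ ≡ m

IsLeast : Pred ℕ 0ℓ → Pred ℕ 0ℓ
IsLeast P m = P m × (∀ n → P n → m ℕ.≤ n)

least : {P : Pred ℕ 0ℓ} → Decidable P → ∀ n → P n → ∃ (IsLeast P)
least P? zero    p = zero , p , λ _ _ → z≤n
least P? (suc n) p with P? 0
... | yes p₀ = zero , p₀ , λ _ _ → z≤n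
... | no ¬p₀ with m , pₘ , m≤ ← least (P? ∘ suc) n p =
  suc m , pₘ , λ where
    zero    p₀ → contradiction p₀ ¬p₀
    (suc j) pⱼ → s≤s (m≤ j pⱼ)

leastDominatingSize : ∀ G → ∃ (IsLeast (DominatingSize G))
leastDominatingSize G =
  least (λ m → anySubset? λ S → dominating? G S ×-dec (∣ S ∣ ℕ.≟ m))
        ∣ ⊤ {Graph.order G} ∣
        (⊤ , (λ v v∉⊤ → contradiction ∈⊤ v∉⊤) , refl)

γ : Graph → ℕ
γ G = proj₁ (leastDominatingSize G)

γ-isLeast : ∀ G → IsLeast (DominatingSize G) (γ G)
γ-isLeast G = proj₂ (leastDominatingSize G)

module _ (G F : Graph) where
  private
    module G = Graph G
    module F = Graph F

  -- The last three fields say that π restricts, for each vertex v of G, to a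
  -- bijection from the neighbours of v onto the neighbours of π v.
  record IsCovering (π : Vertex G → Vertex F) : Set where
    field
      surjective : Surjective _≡_ _≡_ π
      preserves  : ∀ {v w} → G.Adj v w → F.Adj (π v) (π w)
      injectiveₙ  : ∀ {v w w′} → G.Adj v w → G.Adj v w′ → π w ≡ π w′ → w ≡ w′
      surjectiveₙ : ∀ {v u} → F.Adj (π v) u → ∃ λ w → G.Adj v w × π w ≡ u

  fibre : (Vertex G → Vertex F) → Vertex F → Subset G.order
  fibre π u = tabulate (λ v → does (π v ≟ u))

  IsFoldCover : ℕ → Set
  IsFoldCover k = ∃ λ π → IsCovering π × (∀ u → ∣ fibre π u ∣ ≡ k)

H : ℕ → ℚ
H zero    = 0ℚ
H (suc n) = H n ℚ.+ + 1 / suc n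

H-nonNegative : ∀ n → ℚ.NonNegative (H n)
H-nonNegative zero    = _
H-nonNegative (suc n) =
  ℚ.nonNeg+nonNeg⇒nonNeg (H n) {{H-nonNegative n}}
    (+ 1 / suc n) {{ℚ.normalize-nonNeg 1 (suc n)}}

H-positive : ∀ {n} → n ℕ.≥ 1 → ℚ.Positive (H n)
H-positive {suc n} _ =
  ℚ.nonNeg+pos⇒pos (H n) {{H-nonNegative n}}
    (+ 1 / suc n) {{ℚ.normalize-pos 1 (suc n)}}

H-nonZero : ∀ {n} → n ℕ.≥ 1 → ℚ.NonZero (H n)
H-nonZero {n} n≥1 = ℚ.pos⇒nonZero (H n) {{H-positive n≥1}}

fromℕ : ℕ → ℚ
fromℕ n = + n / 1

{-# OPTIONS --safe #-}

-- Let S be a minimum dominating set of G and let w(u) be the number of elements of S above u. The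
-- dominators of the k lifts of a vertex v are distinct and lie above the closed neighbourhood N[v], so
-- w(N[v]) ≥ k. By weak duality any y ≥ 0 with y(N[u]) ≤ B for all u satisfies k Σ y ≤ B Σ w = B γ(G), and
-- it remains to find y with H(Δ) Σ y ≥ B γ(F).
--
-- Lovász's greedy argument gives only H(Δ+1) because closed neighbourhoods have Δ+1 elements. The gain
-- comes from its last stages: when every closed neighbourhood contains at most two undominated vertices,
-- a minimum cover of these by pairs and singles is cheaper than the greedy one. This yields
-- H(Δ+1) - 1/6 ≤ H(Δ) for Δ ≥ 5.
-- For Δ = 4 the same argument works once the centres of the stars chosen in the first two stages, which
-- are then themselves undominated, get a larger price than their leaves.
-- For Δ ≤ 3 the vertices are partitioned into γ(F) stars, each with at least two vertices unless its
-- centre is isolated, and each star distributes a fixed amount among its vertices.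
module Submission where

open import Defs
open import Data.Bool.Base using (Bool; true; false; if_then_else_; _∧_; not)
import Data.Bool.Properties as Bool
open import Data.Fin.Base using (Fin; zero; suc; punchIn; punchOut)
open import Data.Fin.Properties using (_≟_; any?; all?; punchIn-punchOut)
open import Data.Fin.Subset using (Subset; _∈_; ∣_∣)
open import Data.Fin.Subset.Properties using (_∈?_; drop-there)
import Data.Integer.Base as ℤ
import Data.Integer.Properties as ℤ
open import Data.List.Base as List using (List; []; _∷_; length; map; allFin; _++_)
open import Data.List.Extrema.Nat using (xs≤max)
open import Data.List.Membership.DecPropositional using () renaming (_∈?_ to ∈ₗ?)
open import Data.List.Membership.Propositional using () renaming (_∈_ to _∈ₗ_)
open import Data.List.Membership.Propositional.Properties using (∈-map⁺; ∈-allFin; ∈-tabulate⁺; ∈-++⁺ˡ; ∈-++⁺ʳ)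
open import Data.List.Properties using (length-tabulate; length-++)
import Data.List.Relation.Unary.All as All
open import Data.List.Relation.Unary.Any using (here; there)
open import Data.Nat.Base
open import Data.Nat.Properties hiding (_≟_)
import Data.Nat.Properties as ℕ
open import Data.Nat.Tactic.RingSolver using (solve-∀)
open import Data.Product.Base using (∃; _×_; _,_; proj₁; proj₂)
open import Data.Rational.Base as ℚ using (1ℚ; 1/_)
import Data.Rational.Properties as ℚ
import Data.Rational.Unnormalised.Base as ℚᵘ
import Data.Rational.Unnormalised.Properties as ℚᵘ
open import Data.Sum.Base using (_⊎_; inj₁; inj₂)
open import Data.Vec.Base as Vec using (Vec; []; _∷_; lookup; here; there)
open import Data.Vec.Properties using (lookup⇒[]=; lookup∘tabulate)
open import Function.Base using (_∘_; _$_; id; case_of_)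
open import Relation.Binary.PropositionalEquality
open import Relation.Nullary.Decidable using (Dec; yes; no; does; _⊎-dec_; _×-dec_; _→-dec_; ¬?; map′; dec-true; dec-false)
open import Relation.Nullary.Negation using (¬_; contradiction)
open import Algebra.Properties.Semiring.Sum +-*-semiring
  using (sum; sum-cong-≗; ∑-distrib-+; ∑-comm; *-distribˡ-sum; *-distribʳ-sum; sum-replicate-zero)

-- Where 1/6 comes from: if no closed neighbourhood has more than two undominated vertices, the
-- greedy estimate for k times the number of remaining picks is 3/2 γ(G); a minimum cover of size m
-- satisfies 3m ≤ |U| + y(V) with two packings of bound 2, which gives 4/3 γ(G). The result H(Δ+1) -
-- 1/6 misses H(4) by 1/30 and H(3) by 1/12, so small degrees need packings of their own. For Δ = 4
-- the target is H(4) = 375/180 with 180 per star. Equal prices 36 and 45 in stars of five and four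
-- vertices would allow a load of 36 + 45 + 3 * 60 + 2 * 60 = 381. If no price exceeds the 60 of a
-- remaining vertex, a leaf of a four-star is worth at least 40 (its centre 60). A leaf of a
-- five-star may then be worth at most 35, so its centre is worth at least 40, and such a leaf and
-- its centre together again make 75. With these values each critical closed neighbourhood carries
-- 35 + 40 + 3 * 60 + 2 * 60 = 375.

-- Indicator functions and finite sums.

𝟙 : {P : Set} → Dec P → ℕ
𝟙 P? = if does P? then 1 else 0

𝟙-yes : {P : Set} (P? : Dec P) → P → 𝟙 P? ≡ 1
𝟙-yes (yes _) _ = refl
𝟙-yes (no ¬p) p = contradiction p ¬p

𝟙-no : {P : Set} (P? : Dec P) → ¬ P → 𝟙 P? ≡ 0
𝟙-no (yes p) ¬p = contradiction p ¬p
𝟙-no (no _)  _  = refl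

𝟙≤1 : {P : Set} (P? : Dec P) → 𝟙 P? ≤ 1
𝟙≤1 (yes _) = ≤-refl
𝟙≤1 (no _)  = z≤n

𝟙-mono : {P Q : Set} (P? : Dec P) (Q? : Dec Q) → (P → Q) → 𝟙 P? ≤ 𝟙 Q?
𝟙-mono (yes p) Q? f = ≤-reflexive (sym (𝟙-yes Q? (f p)))
𝟙-mono (no _)  Q? f = z≤n

𝟙-cong : {P Q : Set} (P? : Dec P) (Q? : Dec Q) → (P → Q) → (Q → P) → 𝟙 P? ≡ 𝟙 Q?
𝟙-cong P? Q? f g = ≤-antisym (𝟙-mono P? Q? f) (𝟙-mono Q? P? g)

𝟙-elim-≤ : {P : Set} (P? : Dec P) {x : ℕ} → (P → 1 ≤ x) → 𝟙 P? ≤ x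
𝟙-elim-≤ (yes p) 1≤x = 1≤x p
𝟙-elim-≤ (no _)  1≤x = z≤n

𝟙*-mono : {P : Set} (P? : Dec P) {x y : ℕ} → (P → x ≤ y) → 𝟙 P? * x ≤ 𝟙 P? * y
𝟙*-mono (yes p) x≤y = *-monoʳ-≤ 1 (x≤y p)
𝟙*-mono (no _)  x≤y = z≤n

sum-mono : ∀ {n} {f g : Fin n → ℕ} → (∀ i → f i ≤ g i) → sum f ≤ sum g
sum-mono {zero}  f≤g = z≤n
sum-mono {suc n} f≤g = +-mono-≤ (f≤g zero) (sum-mono (f≤g ∘ suc))

sum-zero : ∀ {n} {f : Fin n → ℕ} → (∀ i → f i ≡ 0) → sum f ≡ 0
sum-zero {n} f≡0 = trans (sum-cong-≗ f≡0) (sum-replicate-zero n)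

sum-const : ∀ n c → sum {n} (λ _ → c) ≡ c * n
sum-const zero    c = sym (*-zeroʳ c)
sum-const (suc n) c = trans (cong (c +_) (sum-const n c)) (sym (*-suc c n))

sum-δ : ∀ {n} (a : Fin n) (f : Fin n → ℕ) → sum (λ i → 𝟙 (i ≟ a) * f i) ≡ f a
sum-δ {suc n} zero    f =
  trans (cong₂ _+_ (+-identityʳ (f zero)) (sum-zero {n} (λ _ → refl))) (+-identityʳ _)
sum-δ {suc n} (suc a) f = trans (sum-cong-≗ δ-suc) (sum-δ a (f ∘ suc))
  where
  δ-suc : ∀ i → 𝟙 (suc i ≟ suc a) * f (suc i) ≡ 𝟙 (i ≟ a) * f (suc i)
  δ-suc i = cong (_* f (suc i)) (𝟙-cong (suc i ≟ suc a) (i ≟ a) (λ { refl → refl }) (cong suc))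

sum-𝟙≟ : ∀ {n} (a : Fin n) → sum (λ i → 𝟙 (i ≟ a)) ≡ 1
sum-𝟙≟ a = trans (sum-cong-≗ (λ i → sym (*-identityʳ (𝟙 (i ≟ a))))) (sum-δ a (λ _ → 1))

term≤sum : ∀ {n} (f : Fin n → ℕ) a → f a ≤ sum f
term≤sum f zero    = m≤m+n _ _
term≤sum f (suc a) = ≤-trans (term≤sum (f ∘ suc) a) (m≤n+m _ _)

sum-split : ∀ {n} (f g h : Fin n → ℕ) → (∀ i → f i + g i ≤ h i) → sum f + sum g ≤ sum h
sum-split f g h f+g≤h = ≤-trans (≤-reflexive (sym (∑-distrib-+ f g))) (sum-mono f+g≤h)

two-terms≤sum : ∀ {n} (f : Fin n → ℕ) {a b} → a ≢ b → f a + f b ≤ sum f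
two-terms≤sum f {a} {b} a≢b =
  subst₂ (λ x y → x + y ≤ sum f) (sum-δ a f) (sum-δ b f) (sum-split _ _ f pointwise)
  where
  pointwise : ∀ i → 𝟙 (i ≟ a) * f i + 𝟙 (i ≟ b) * f i ≤ f i
  pointwise i with i ≟ a | i ≟ b
  ... | yes refl | yes refl = contradiction refl a≢b
  ... | yes _    | no _     = ≤-reflexive (trans (+-identityʳ _) (+-identityʳ _))
  ... | no _     | yes _    = ≤-reflexive (+-identityʳ _)
  ... | no _     | no _     = z≤n

three-terms≤sum : ∀ {n} (f : Fin n → ℕ) {a b d} → a ≢ b → a ≢ d → b ≢ d → f a + f b + f d ≤ sum f
three-terms≤sum f {a} {b} {d} a≢b a≢d b≢d = begin
  f a + f b + f d              ≡⟨ cong (f a + f b +_) (sum-δ d f) ⟨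
  f a + f b + sum (at d)       ≡⟨ cong (_+ sum (at d)) (cong₂ _+_ (off a≢d) (off b≢d)) ⟨
  f′ a + f′ b + sum (at d)     ≤⟨ +-monoˡ-≤ (sum (at d)) (two-terms≤sum f′ a≢b) ⟩
  sum f′ + sum (at d)          ≤⟨ sum-split f′ (at d) f pointwise ⟩
  sum f                        ∎
  where
  open ≤-Reasoning
  at : Fin _ → Fin _ → ℕ
  at d i = 𝟙 (i ≟ d) * f i
  f′ : Fin _ → ℕ
  f′ i = f i ∸ at d i
  off : ∀ {i} → i ≢ d → f′ i ≡ f i
  off {i} i≢d rewrite 𝟙-no (i ≟ d) i≢d = refl
  pointwise : ∀ i → f′ i + at d i ≤ f i
  pointwise i = ≤-reflexive (m∸n+n≡m (≤-trans (*-monoˡ-≤ (f i) (𝟙≤1 (i ≟ d))) (≤-reflexive (+-identityʳ (f i)))))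

sum-mono-< : ∀ {n} {f g : Fin n → ℕ} → (∀ i → f i ≤ g i) → ∀ a → f a < g a → sum f < sum g
sum-mono-< {f = f} {g} f≤g a fa<ga =
  subst (_≤ sum g) (trans (cong (sum f +_) (sum-𝟙≟ a)) (+-comm (sum f) 1)) (sum-split f _ g pointwise)
  where
  pointwise : ∀ i → f i + 𝟙 (i ≟ a) ≤ g i
  pointwise i with i ≟ a
  ... | yes refl = subst (_≤ g i) (+-comm 1 (f i)) fa<ga
  ... | no _     = subst (_≤ g i) (sym (+-identityʳ (f i))) (f≤g i)

sum-𝟙≤𝟙 : ∀ {n} {P : Fin n → Set} (P? : ∀ i → Dec (P i)) {Q : Set} (Q? : Dec Q) →
  (∀ {i j} → P i → P j → i ≡ j) → (∀ {i} → P i → Q) → sum (λ i → 𝟙 (P? i)) ≤ 𝟙 Q?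
sum-𝟙≤𝟙 P? Q? unique P⇒Q with any? P?
... | yes (a , pa) = begin
  sum (λ i → 𝟙 (P? i))   ≤⟨ sum-mono (λ i → 𝟙-mono (P? i) (i ≟ a) (λ pi → unique pi pa)) ⟩
  sum (λ i → 𝟙 (i ≟ a))  ≡⟨ sum-𝟙≟ a ⟩
  1                      ≡⟨ 𝟙-yes Q? (P⇒Q pa) ⟨
  𝟙 Q?                   ∎
  where open ≤-Reasoning
... | no ¬∃ = ≤-trans (≤-reflexive (sum-zero (λ i → 𝟙-no (P? i) (λ pi → ¬∃ (i , pi))))) z≤n

𝟙-any≤sum : ∀ {n} {P : Fin n → Set} (P? : ∀ i → Dec (P i)) → 𝟙 (any? P?) ≤ sum (λ i → 𝟙 (P? i))
𝟙-any≤sum P? with any? P?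
... | yes (a , pa) = ≤-trans (≤-reflexive (sym (𝟙-yes (P? a) pa))) (term≤sum (λ i → 𝟙 (P? i)) a)
... | no _         = z≤n

-- Double counting of the related pairs: an `i` in the domain has at least one `j`, while a `j` has
-- at most one `i`.
domain≤codomain : ∀ {m n} {M : Fin m → Fin n → Set} (M? : ∀ i j → Dec (M i j)) →
  (∀ {i i′ j} → M i j → M i′ j → i ≡ i′) →
  sum (λ i → 𝟙 (any? (M? i))) ≤ sum (λ j → 𝟙 (any? (λ i → M? i j)))
domain≤codomain M? functional = begin
  sum (λ i → 𝟙 (any? (M? i)))          ≤⟨ sum-mono (λ i → 𝟙-any≤sum (M? i)) ⟩
  sum (λ i → sum (λ j → 𝟙 (M? i j)))   ≡⟨ ∑-comm (λ i j → 𝟙 (M? i j)) ⟩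
  sum (λ j → sum (λ i → 𝟙 (M? i j)))   ≤⟨ sum-mono (λ j → sum-𝟙≤𝟙 (λ i → M? i j) (any? (λ i → M? i j)) functional (_ ,_)) ⟩
  sum (λ j → 𝟙 (any? (λ i → M? i j)))  ∎
  where open ≤-Reasoning

sum-fibres : ∀ {m n} (c : Fin n → Fin m) (f : Fin n → ℕ) →
  sum f ≡ sum (λ j → sum (λ v → 𝟙 (c v ≟ j) * f v))
sum-fibres c f = begin
  sum f                                          ≡⟨ sum-cong-≗ (λ v → sym (fibre-δ v)) ⟩
  sum (λ v → sum (λ j → 𝟙 (c v ≟ j) * f v))      ≡⟨ ∑-comm (λ v j → 𝟙 (c v ≟ j) * f v) ⟩
  sum (λ j → sum (λ v → 𝟙 (c v ≟ j) * f v))      ∎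
  where
  open ≡-Reasoning
  fibre-δ : ∀ v → sum (λ j → 𝟙 (c v ≟ j) * f v) ≡ f v
  fibre-δ v = trans (sum-cong-≗ (λ j → cong (_* f v) (𝟙-cong (c v ≟ j) (j ≟ c v) sym sym)))
                    (sum-δ (c v) (λ _ → f v))

∣tabulate∣ : ∀ {n} {P : Fin n → Set} (P? : ∀ i → Dec (P i)) →
  ∣ Vec.tabulate (λ i → does (P? i)) ∣ ≡ sum (λ i → 𝟙 (P? i))
∣tabulate∣ {zero}  P? = refl
∣tabulate∣ {suc n} P? with does (P? zero)
... | true  = cong suc (∣tabulate∣ (P? ∘ suc))
... | false = ∣tabulate∣ (P? ∘ suc)

∣∣-sum : ∀ {n} (S : Subset n) → ∣ S ∣ ≡ sum (λ v → 𝟙 (v ∈? S))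
∣∣-sum []          = refl
∣∣-sum (true ∷ S)  = cong suc (trans (∣∣-sum S)
  (sum-cong-≗ (λ v → 𝟙-cong (v ∈? S) (suc v ∈? (true ∷ S)) there drop-there)))
∣∣-sum (false ∷ S) = trans (∣∣-sum S)
  (sum-cong-≗ (λ v → 𝟙-cong (v ∈? S) (suc v ∈? (false ∷ S)) there drop-there))

∈-tabulateˢ : ∀ {n} {P : Fin n → Set} (P? : ∀ i → Dec (P i)) {v} → P v → v ∈ Vec.tabulate (λ i → does (P? i))
∈-tabulateˢ P? {v} p = lookup⇒[]= v _ (trans (lookup∘tabulate _ v) (dec-true (P? v) p))

-- Closed neighbourhoods, weak duality and packings.

module Neighbourhoods (F : Graph) where
  open Graph F using (order; Adj; adj?) renaming (sym to adj-sym)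

  infix 4 _⊲_ _⊲?_

  _⊲_ : Vertex F → Vertex F → Set
  u ⊲ v = u ≡ v ⊎ Adj u v

  _⊲?_ : ∀ u v → Dec (u ⊲ v)
  u ⊲? v = (u ≟ v) ⊎-dec adj? u v

  ⊲-refl : ∀ {u} → u ⊲ u
  ⊲-refl = inj₁ refl

  ⊲-sym : ∀ {u v} → u ⊲ v → v ⊲ u
  ⊲-sym (inj₁ u≡v) = inj₁ (sym u≡v)
  ⊲-sym (inj₂ a)   = inj₂ (adj-sym a)

  N : Vertex F → (Vertex F → ℕ) → ℕ
  N u y = sum (λ v → 𝟙 (u ⊲? v) * y v)

  N-mono : ∀ u {y z} → (∀ {v} → u ⊲ v → y v ≤ z v) → N u y ≤ N u z
  N-mono u y≤z = sum-mono (λ v → 𝟙*-mono (u ⊲? v) y≤z)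

  N-+ : ∀ u y z → N u (λ v → y v + z v) ≡ N u y + N u z
  N-+ u y z = trans (sum-cong-≗ (λ v → *-distribˡ-+ (𝟙 (u ⊲? v)) (y v) (z v)))
                    (∑-distrib-+ (λ v → 𝟙 (u ⊲? v) * y v) _)

  N-* : ∀ u c y → N u (λ v → c * y v) ≡ c * N u y
  N-* u c y = trans (sum-cong-≗ (λ v → swap (𝟙 (u ⊲? v)) c (y v)))
                    (sym (*-distribˡ-sum c (λ v → 𝟙 (u ⊲? v) * y v)))
    where
    swap : ∀ a b c → a * (b * c) ≡ b * (a * c)
    swap a b c = trans (sym (*-assoc a b c)) (trans (cong (_* c) (*-comm a b)) (*-assoc b a c))

  N-δ : ∀ {u a} → u ⊲ a → ∀ (c : ℕ) → N u (λ v → c * 𝟙 (v ≟ a)) ≡ c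
  N-δ {u} {a} u⊲a c = begin
    N u (λ v → c * 𝟙 (v ≟ a))                    ≡⟨ N-* u c (λ v → 𝟙 (v ≟ a)) ⟩
    c * N u (λ v → 𝟙 (v ≟ a))                    ≡⟨ cong (c *_) (sum-cong-≗ (λ v → *-comm (𝟙 (u ⊲? v)) (𝟙 (v ≟ a)))) ⟩
    c * sum (λ v → 𝟙 (v ≟ a) * 𝟙 (u ⊲? v))       ≡⟨ cong (c *_) (sum-δ a (λ v → 𝟙 (u ⊲? v))) ⟩
    c * 𝟙 (u ⊲? a)                               ≡⟨ cong (c *_) (𝟙-yes (u ⊲? a) u⊲a) ⟩
    c * 1                                        ≡⟨ *-identityʳ c ⟩
    c                                            ∎
    where open ≡-Reasoning

  N-const : ∀ u c → N u (λ _ → c) ≡ c * N u (λ _ → 1)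
  N-const u c = trans (sum-cong-≗ (λ v → cong (𝟙 (u ⊲? v) *_) (sym (*-identityʳ c)))) (N-* u c (λ _ → 1))

  degree≤maxDegree : ∀ v → degree F v ≤ maxDegree F
  degree≤maxDegree v =
    All.lookup (xs≤max 0 (map (degree F) (allFin order))) (∈-map⁺ (degree F) (∈-allFin v))

  ∣N∣≤1+Δ : ∀ u → N u (λ _ → 1) ≤ suc (maxDegree F)
  ∣N∣≤1+Δ u = begin
    sum (λ v → 𝟙 (u ⊲? v) * 1)                          ≤⟨ sum-mono pointwise ⟩
    sum (λ v → 𝟙 (v ≟ u) + 𝟙 (adj? u v))                ≡⟨ ∑-distrib-+ (λ v → 𝟙 (v ≟ u)) _ ⟩
    sum (λ v → 𝟙 (v ≟ u)) + sum (λ v → 𝟙 (adj? u v))    ≡⟨ cong₂ _+_ (sum-𝟙≟ u) (sym (∣tabulate∣ (adj? u))) ⟩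
    suc (degree F u)                                    ≤⟨ s≤s (degree≤maxDegree u) ⟩
    suc (maxDegree F)                                   ∎
    where
    open ≤-Reasoning
    pointwise : ∀ v → 𝟙 (u ⊲? v) * 1 ≤ 𝟙 (v ≟ u) + 𝟙 (adj? u v)
    pointwise v = subst (_≤ 𝟙 (v ≟ u) + 𝟙 (adj? u v)) (sym (*-identityʳ _)) $ 𝟙-elim-≤ (u ⊲? v) λ where
      (inj₁ u≡v) → ≤-trans (≤-reflexive (sym (𝟙-yes (v ≟ u) (sym u≡v)))) (m≤m+n _ _)
      (inj₂ a)   → ≤-trans (≤-reflexive (sym (𝟙-yes (adj? u v) a))) (m≤n+m _ (𝟙 (v ≟ u)))

  module _ (k : ℕ) (w : Vertex F → ℕ) (k≤Nw : ∀ v → k ≤ N v w) where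

    -- The products `w u * y v` with `v ⊲ u` are summed in both orders; as `⊲` is symmetric, both
    -- orders give sums over closed neighbourhoods.
    weak-duality : ∀ (y : Vertex F → ℕ) B → (∀ u → N u y ≤ B) → k * sum y ≤ B * sum w
    weak-duality y B Ny≤B = begin
      k * sum y                                                 ≡⟨ *-distribˡ-sum k y ⟩
      sum (λ v → k * y v)                                       ≤⟨ sum-mono (λ v → *-monoˡ-≤ (y v) (k≤Nw v)) ⟩
      sum (λ v → N v w * y v)                                   ≡⟨ sum-cong-≗ (λ v → *-distribʳ-sum (y v) (λ u → 𝟙 (v ⊲? u) * w u)) ⟩
      sum (λ v → sum (λ u → 𝟙 (v ⊲? u) * w u * y v))            ≡⟨ ∑-comm (λ v u → 𝟙 (v ⊲? u) * w u * y v) ⟩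
      sum (λ u → sum (λ v → 𝟙 (v ⊲? u) * w u * y v))            ≡⟨ sum-cong-≗ (λ u → sum-cong-≗ (λ v → rearrange u v)) ⟩
      sum (λ u → sum (λ v → 𝟙 (u ⊲? v) * y v * w u))            ≡⟨ sum-cong-≗ (λ u → sym (*-distribʳ-sum (w u) (λ v → 𝟙 (u ⊲? v) * y v))) ⟩
      sum (λ u → N u y * w u)                                   ≤⟨ sum-mono (λ u → *-monoˡ-≤ (w u) (Ny≤B u)) ⟩
      sum (λ u → B * w u)                                       ≡⟨ *-distribˡ-sum B w ⟨
      B * sum w                                                 ∎
      where
      open ≤-Reasoning
      rearrange : ∀ u v → 𝟙 (v ⊲? u) * w u * y v ≡ 𝟙 (u ⊲? v) * y v * w u
      rearrange u v rewrite 𝟙-cong (v ⊲? u) (u ⊲? v) ⊲-sym ⊲-sym =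
        trans (*-assoc (𝟙 (u ⊲? v)) (w u) (y v))
          (trans (cong (𝟙 (u ⊲? v) *_) (*-comm (w u) (y v))) (sym (*-assoc (𝟙 (u ⊲? v)) (y v) (w u))))

  -- By `weak-duality` this yields `A * (k * γ F) ≤ B * sum w`, so the aim is `B / A` equal to the
  -- harmonic number. Two integers in place of one ratio keep all prices in ℕ.
  Packing : ℕ → ℕ → Set
  Packing A B = ∃ λ y → A * γ F ≤ sum y × (∀ u → N u y ≤ B)

  γ≤length : (D : List (Vertex F)) → (∀ v → ∃ λ d → d ∈ₗ D × v ⊲ d) → γ F ≤ length D
  γ≤length D covers = begin
    γ F                              ≤⟨ proj₂ (γ-isLeast F) _ (S , dominating , refl) ⟩
    ∣ S ∣                            ≡⟨ ∣tabulate∣ (λ v → ∈ₗ? _≟_ v D) ⟩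
    sum (λ v → 𝟙 (∈ₗ? _≟_ v D))      ≤⟨ count D ⟩
    length D                         ∎
    where
    open ≤-Reasoning
    S : Subset order
    S = Vec.tabulate (λ v → does (∈ₗ? _≟_ v D))
    dominating : Dominating F S
    dominating v v∉S with covers v
    ... | d , d∈D , inj₁ refl = contradiction (∈-tabulateˢ (λ v → ∈ₗ? _≟_ v D) d∈D) v∉S
    ... | d , d∈D , inj₂ a    = d , ∈-tabulateˢ (λ v → ∈ₗ? _≟_ v D) d∈D , a
    count : ∀ D → sum (λ v → 𝟙 (∈ₗ? _≟_ v D)) ≤ length D
    count []      = ≤-reflexive (sum-zero {order} (λ _ → refl))
    count (d ∷ D) = begin
      sum (λ v → 𝟙 (∈ₗ? _≟_ v (d ∷ D)))                       ≤⟨ sum-mono pointwise ⟩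
      sum (λ v → 𝟙 (v ≟ d) + 𝟙 (∈ₗ? _≟_ v D))                 ≡⟨ ∑-distrib-+ (λ v → 𝟙 (v ≟ d)) _ ⟩
      sum (λ v → 𝟙 (v ≟ d)) + sum (λ v → 𝟙 (∈ₗ? _≟_ v D))     ≤⟨ +-mono-≤ (≤-reflexive (sum-𝟙≟ d)) (count D) ⟩
      suc (length D)                                          ∎
      where
      pointwise : ∀ v → 𝟙 (∈ₗ? _≟_ v (d ∷ D)) ≤ 𝟙 (v ≟ d) + 𝟙 (∈ₗ? _≟_ v D)
      pointwise v = 𝟙-elim-≤ (∈ₗ? _≟_ v (d ∷ D)) λ where
        (here eq)  → ≤-trans (≤-reflexive (sym (𝟙-yes (v ≟ d) eq))) (m≤m+n _ _)
        (there v∈) → ≤-trans (≤-reflexive (sym (𝟙-yes (∈ₗ? _≟_ v D) v∈))) (m≤n+m _ (𝟙 (v ≟ d)))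

-- The weight on `F` induced by a dominating set of its cover.

module Projection {F G : Graph} {k : ℕ} {π : Vertex G → Vertex F}
  (covering : IsCovering G F π) (k-fold : ∀ u → ∣ fibre G F π u ∣ ≡ k)
  (S : Subset (Graph.order G)) (dominating : Dominating G S) where
  private
    module F = Graph F
    module G = Graph G
    module NF = Neighbourhoods F
    module NG = Neighbourhoods G
  open IsCovering covering

  weight : Vertex F → ℕ
  weight u = sum (λ s → 𝟙 (π s ≟ u) * 𝟙 (s ∈? S))

  sum-weight : sum weight ≡ ∣ S ∣
  sum-weight = trans (sym (sum-fibres π (λ s → 𝟙 (s ∈? S)))) (sym (∣∣-sum S))

  -- Covering maps are injective on open neighbourhoods only by definition; for closed ones, a
  -- vertex and its neighbour have adjacent images, hence different ones because `F` has no loops.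
  ⊲-injective : ∀ {s g h} → s NG.⊲ g → s NG.⊲ h → π g ≡ π h → g ≡ h
  ⊲-injective (inj₁ refl) (inj₁ refl) _  = refl
  ⊲-injective (inj₁ refl) (inj₂ a)    eq = contradiction (preserves a) (F.irrefl eq)
  ⊲-injective (inj₂ a)    (inj₁ refl) eq = contradiction (preserves a) (F.irrefl (sym eq))
  ⊲-injective (inj₂ a)    (inj₂ b)    eq = injectiveₙ a b eq

  ⊲-preserves : ∀ {g h} → g NG.⊲ h → π g NF.⊲ π h
  ⊲-preserves (inj₁ refl) = inj₁ refl
  ⊲-preserves (inj₂ a)    = inj₂ (preserves a)

  dominator : ∀ g → ∃ λ s → s ∈ S × g NG.⊲ s
  dominator g with g ∈? S
  ... | yes g∈S = g , g∈S , NG.⊲-refl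
  ... | no g∉S with s , s∈S , a ← dominating g g∉S = s , s∈S , inj₂ a

  -- Each of the k lifts of v has a dominator in S, and an element of S dominates at most one lift.
  k≤N-weight : ∀ v → k ≤ NF.N v weight
  k≤N-weight v = begin
    k                                                                ≡⟨ k-fold v ⟨
    ∣ fibre G F π v ∣                                                ≡⟨ ∣tabulate∣ (λ g → π g ≟ v) ⟩
    sum (λ g → 𝟙 (π g ≟ v))                                          ≤⟨ sum-mono has-dominator ⟩
    sum (λ g → sum (λ s → 𝟙 (lift? s g)))                            ≡⟨ ∑-comm (λ g s → 𝟙 (lift? s g)) ⟩
    sum (λ s → sum (λ g → 𝟙 (lift? s g)))                            ≤⟨ sum-mono (λ s → sum-𝟙≤𝟙 (lift? s) (v NF.⊲? π s ×-dec s ∈? S) unique below) ⟩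
    sum (λ s → 𝟙 (v NF.⊲? π s ×-dec s ∈? S))                         ≤⟨ sum-mono (λ s → 𝟙-× (v NF.⊲? π s) (s ∈? S)) ⟩
    sum (λ s → 𝟙 (v NF.⊲? π s) * 𝟙 (s ∈? S))                         ≡⟨ sum-fibres π _ ⟩
    sum (λ u → sum (λ s → 𝟙 (π s ≟ u) * (𝟙 (v NF.⊲? π s) * 𝟙 (s ∈? S))))
                                                                     ≡⟨ sum-cong-≗ (λ u → trans (sum-cong-≗ (λ s → pull u s)) (sym (*-distribˡ-sum (𝟙 (v NF.⊲? u)) (λ s → 𝟙 (π s ≟ u) * 𝟙 (s ∈? S))))) ⟩
    NF.N v weight                                                    ∎
    where
    open ≤-Reasoning
    Lift : Vertex G → Vertex G → Set
    Lift s g = (s ∈ S × s NG.⊲ g) × π g ≡ v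
    lift? : ∀ s g → Dec (Lift s g)
    lift? s g = (s ∈? S ×-dec s NG.⊲? g) ×-dec π g ≟ v
    has-dominator : ∀ g → 𝟙 (π g ≟ v) ≤ sum (λ s → 𝟙 (lift? s g))
    has-dominator g with dominator g
    ... | s , s∈S , g⊲s =
      ≤-trans (𝟙-mono (π g ≟ v) (lift? s g) (λ eq → (s∈S , NG.⊲-sym g⊲s) , eq))
              (term≤sum (λ s → 𝟙 (lift? s g)) s)
    unique : ∀ {s g h} → Lift s g → Lift s h → g ≡ h
    unique ((_ , s⊲g) , πg≡v) ((_ , s⊲h) , πh≡v) = ⊲-injective s⊲g s⊲h (trans πg≡v (sym πh≡v))
    below : ∀ {s g} → Lift s g → v NF.⊲ π s × s ∈ S
    below ((s∈S , s⊲g) , refl) = ⊲-preserves (NG.⊲-sym s⊲g) , s∈S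
    𝟙-× : {P Q : Set} (P? : Dec P) (Q? : Dec Q) → 𝟙 (P? ×-dec Q?) ≤ 𝟙 P? * 𝟙 Q?
    𝟙-× (yes _) (yes _) = ≤-refl
    𝟙-× (yes _) (no _)  = z≤n
    𝟙-× (no _)  _       = z≤n
    pull : ∀ u s → 𝟙 (π s ≟ u) * (𝟙 (v NF.⊲? π s) * 𝟙 (s ∈? S)) ≡
                   𝟙 (v NF.⊲? u) * (𝟙 (π s ≟ u) * 𝟙 (s ∈? S))
    pull u s with π s ≟ u
    ... | yes refl = trans (+-identityʳ _) (cong (𝟙 (v NF.⊲? π s) *_) (sym (+-identityʳ _)))
    ... | no _     = sym (*-zeroʳ (𝟙 (v NF.⊲? u)))

-- Minimum covers and exchange arguments.

anyVec? : ∀ {n} m {P : Vec (Fin n) m → Set} → (∀ xs → Dec (P xs)) → Dec (∃ P)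
anyVec? zero    P? = map′ ([] ,_) (λ { ([] , p) → p }) (P? [])
anyVec? (suc m) P? =
  map′ (λ { (x , xs , p) → x ∷ xs , p }) (λ { (x ∷ xs , p) → x , xs , p })
       (any? λ x → anyVec? m λ xs → P? (x ∷ xs))

_[_≔_] : ∀ {m} {A : Set} → (Fin m → A) → Fin m → A → Fin m → A
(f [ i ≔ a ]) j = if does (j ≟ i) then a else f j

≔-at : ∀ {m} {A : Set} (f : Fin m → A) i a → (f [ i ≔ a ]) i ≡ a
≔-at f i a with i ≟ i
... | yes _  = refl
... | no i≢i = contradiction refl i≢i

≔-off : ∀ {m} {A : Set} (f : Fin m → A) {i j} a → j ≢ i → (f [ i ≔ a ]) j ≡ f j
≔-off f {i} {j} a j≢i with j ≟ i
... | yes j≡i = contradiction j≡i j≢i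
... | no _    = refl

χ : {A : Set} → (A → Bool) → A → ℕ
χ U v = if U v then 1 else 0

module MinimumCovers (F : Graph) where
  open Graph F using (order)
  open Neighbourhoods F

  private
    V = Vertex F

  -- `minimal` rules out every family on the same index set that still covers `U` when one index is
  -- ignored. In this form an exchange merely overwrites centres; reindexing happens only once, in
  -- `minCover`.
  record MinCover (U : V → Bool) : Set where
    field
      size    : ℕ
      centre  : Fin size → V
      covers  : ∀ v → U v ≡ true → ∃ λ j → v ⊲ centre j
      minimal : ∀ (g : Fin size → V) i → ¬ (∀ v → U v ≡ true → ∃ λ j → j ≢ i × v ⊲ g j)

  minCover : ∀ U → MinCover U
  minCover U with least decidable order (Vec.allFin order , λ v _ → v , inj₁ (sym (lookup∘tabulate id v)))
    where
    decidable : ∀ m → Dec (∃ λ (xs : Vec V m) → ∀ v → U v ≡ true → ∃ λ j → v ⊲ lookup xs j)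
    decidable m = anyVec? m λ xs → all? λ v → (U v Bool.≟ true) →-dec any? λ j → v ⊲? lookup xs j
  ... | m , (xs , covers) , least-m = record
    { size    = m
    ; centre  = lookup xs
    ; covers  = covers
    ; minimal = minimal m least-m
    }
    where
    minimal : ∀ m → (∀ l → (∃ λ (xs : Vec V l) → ∀ v → U v ≡ true → ∃ λ j → v ⊲ lookup xs j) → m ≤ l) →
      ∀ (g : Fin m → V) i → ¬ (∀ v → U v ≡ true → ∃ λ j → j ≢ i × v ⊲ g j)
    minimal (suc m) least-m g i g-covers = n≮n m (least-m m (Vec.tabulate (g ∘ punchIn i) , smaller))
      where
      smaller : ∀ v → U v ≡ true → ∃ λ j → v ⊲ lookup (Vec.tabulate (g ∘ punchIn i)) j
      smaller v Uv with j , j≢i , v⊲gj ← g-covers v Uv =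
        punchOut (j≢i ∘ sym) ,
        subst (v ⊲_) (sym (trans (lookup∘tabulate (g ∘ punchIn i) _) (cong g (punchIn-punchOut _)))) v⊲gj

  module Exchange {U : V → Bool} (M : MinCover U) (c : V → Fin (MinCover.size M))
    (c-covers : ∀ v → U v ≡ true → v ⊲ MinCover.centre M (c v)) where
    open MinCover M

    -- Otherwise the vertices of part `i` pass to other centres, all remaining ones keep theirs, and
    -- index `i` is free.
    exchange₁ : ∀ i → ¬ (∀ v → U v ≡ true → c v ≡ i → ∃ λ j → j ≢ i × v ⊲ centre j)
    exchange₁ i covered = minimal centre i λ v Uv → case v Uv
      where
      case : ∀ v → U v ≡ true → ∃ λ j → j ≢ i × v ⊲ centre j
      case v Uv with c v ≟ i
      ... | yes cv≡i = covered v Uv cv≡i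
      ... | no cv≢i  = c v , cv≢i , c-covers v Uv

    -- Otherwise `y` replaces centre `j` and serves both parts, which frees index `i`.
    exchange₂ : ∀ {i j} y → i ≢ j → ¬ (∀ v → U v ≡ true → c v ≡ i ⊎ c v ≡ j → v ⊲ y)
    exchange₂ {i} {j} y i≢j covered = minimal g i λ v Uv → case v Uv
      where
      g = centre [ j ≔ y ]
      by-y : ∀ {v} → v ⊲ y → ∃ λ l → l ≢ i × v ⊲ g l
      by-y v⊲y = j , i≢j ∘ sym , subst (_ ⊲_) (sym (≔-at centre j y)) v⊲y
      case : ∀ v → U v ≡ true → ∃ λ l → l ≢ i × v ⊲ g l
      case v Uv with c v ≟ i | c v ≟ j
      ... | yes cv≡i | _        = by-y (covered v Uv (inj₁ cv≡i))
      ... | no _     | yes cv≡j = by-y (covered v Uv (inj₂ cv≡j))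
      ... | no cv≢i  | no cv≢j  = c v , cv≢i , subst (v ⊲_) (sym (≔-off centre y cv≢j)) (c-covers v Uv)

    -- Otherwise `y` and `z`, put at the indices `j` and `k`, serve three parts. For two singles and
    -- a pair this is an augmenting path of length three.
    exchange₃ : ∀ {i j k} y z → i ≢ j → i ≢ k → j ≢ k →
      ¬ (∀ v → U v ≡ true → c v ≡ i ⊎ c v ≡ j ⊎ c v ≡ k → v ⊲ y ⊎ v ⊲ z)
    exchange₃ {i} {j} {k} y z i≢j i≢k j≢k covered = minimal g i λ v Uv → case v Uv
      where
      g = (centre [ j ≔ y ]) [ k ≔ z ]
      by-yz : ∀ {v} → v ⊲ y ⊎ v ⊲ z → ∃ λ l → l ≢ i × v ⊲ g l
      by-yz (inj₁ v⊲y) = j , i≢j ∘ sym ,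
        subst (_ ⊲_) (sym (trans (≔-off (centre [ j ≔ y ]) z j≢k) (≔-at centre j y))) v⊲y
      by-yz (inj₂ v⊲z) = k , i≢k ∘ sym , subst (_ ⊲_) (sym (≔-at (centre [ j ≔ y ]) k z)) v⊲z
      case : ∀ v → U v ≡ true → ∃ λ l → l ≢ i × v ⊲ g l
      case v Uv with c v ≟ i | c v ≟ j | c v ≟ k
      ... | yes cv≡i | _        | _        = by-yz (covered v Uv (inj₁ cv≡i))
      ... | no _     | yes cv≡j | _        = by-yz (covered v Uv (inj₂ (inj₁ cv≡j)))
      ... | no _     | no _     | yes cv≡k = by-yz (covered v Uv (inj₂ (inj₂ cv≡k)))
      ... | no cv≢i  | no cv≢j  | no cv≢k  =
        c v , cv≢i ,
        subst (v ⊲_) (sym (trans (≔-off (centre [ j ≔ y ]) z cv≢k) (≔-off centre y cv≢j))) (c-covers v Uv)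

  Covered : (V → Bool) → List V → Set
  Covered U D = ∀ v → U v ≡ true → ∃ λ d → d ∈ₗ D × v ⊲ d

  three≤N : ∀ {y : V → ℕ} {u a b d} → a ≢ b → a ≢ d → b ≢ d → u ⊲ a → u ⊲ b → u ⊲ d →
    1 ≤ y a → 1 ≤ y b → 1 ≤ y d → 3 ≤ N u y
  three≤N {y} {u} {a} {b} {d} a≢b a≢d b≢d u⊲a u⊲b u⊲d ya yb yd =
    ≤-trans (+-mono-≤ (+-mono-≤ (counted u⊲a ya) (counted u⊲b yb)) (counted u⊲d yd))
            (three-terms≤sum (λ v → 𝟙 (u ⊲? v) * y v) a≢b a≢d b≢d)
    where
    counted : ∀ {v} → u ⊲ v → 1 ≤ y v → 1 ≤ 𝟙 (u ⊲? v) * y v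
    counted {v} u⊲v 1≤y rewrite 𝟙-yes (u ⊲? v) u⊲v = ≤-trans 1≤y (m≤m+n _ _)

  -- Every closed neighbourhood meets U in at most two vertices: a minimum cover then consists of pairs
  -- and singles, and a packing y of value at least (number of pairs) + 2 (number of singles) is read off
  -- from the absence of augmenting exchanges that involve at most three parts.
  module TwoBounded (U : V → Bool) (N≤2 : ∀ u → N u (χ U) ≤ 2) where

    -- Pairs and singles of a minimum cover, and the packing read off from them.

    module Parts (M : MinCover U) (c : V → Fin (MinCover.size M))
      (c-covers : ∀ v → U v ≡ true → v ⊲ MinCover.centre M (c v)) where
      open MinCover M renaming (size to m) using (centre)
      open Exchange M c c-covers

      Partner : V → V → Set
      Partner v b = b ≢ v × U b ≡ true × c b ≡ c v

      abstract
        partner? : ∀ v → Dec (∃ (Partner v))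
        partner? v = any? λ b → ¬? (b ≟ v) ×-dec (U b Bool.≟ true) ×-dec (c b ≟ c v)

      Single : V → Set
      Single x = U x ≡ true × ¬ ∃ (Partner x)

      abstract
        single? : ∀ x → Dec (Single x)
        single? x = (U x Bool.≟ true) ×-dec ¬? (partner? x)

      _≈_ : V → V → Set
      x ≈ v = ∃ λ u → x ⊲ u × v ⊲ u

      abstract
        _≈?_ : ∀ x v → Dec (x ≈ v)
        x ≈? v = any? λ u → (x ⊲? u) ×-dec (v ⊲? u)

      Hit : V → Set
      Hit v = ∃ λ x → Single x × x ≈ v

      abstract
        hit? : ∀ v → Dec (Hit v)
        hit? v = any? λ x → single? x ×-dec (x ≈? v)

      PartnerHit : V → Set
      PartnerHit v = ∃ λ b → Partner v b × Hit b

      abstract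
        partnerHit? : ∀ v → Dec (PartnerHit v)
        partnerHit? v = any? λ b → (¬? (b ≟ v) ×-dec (U b Bool.≟ true) ×-dec (c b ≟ c v)) ×-dec hit? b

      Triangle : V → Fin m → Set
      Triangle x j = ∃ λ a → ∃ λ b → (U a ≡ true × c a ≡ j) × Partner a b × x ≈ a × x ≈ b

      abstract
        triangle? : ∀ x j → Dec (Triangle x j)
        triangle? x j = any? λ a → any? λ b → ((U a Bool.≟ true) ×-dec (c a ≟ j)) ×-dec
          (¬? (b ≟ a) ×-dec (U b Bool.≟ true) ×-dec (c b ≟ c a)) ×-dec (x ≈? a) ×-dec (x ≈? b)

      -- The truncated differences encode: a paired vertex gets 1, but 0 if it is hit by a single
      -- and its partner is not; a single gets 2, but 1 if it hits both vertices of some pair. A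
      -- pair is thus worth 1 or 2, and it is worth 2 in a triangle, which makes up for the unit
      -- lost by the single.
      y′ : V → ℕ
      y′ v = if does (partner? v) then 1 ∸ (𝟙 (hit? v) ∸ 𝟙 (partnerHit? v))
                                  else 2 ∸ 𝟙 (any? (triangle? v))

      y : V → ℕ
      y v = if U v then y′ v else 0

      χ≡1 : ∀ {v} → U v ≡ true → χ U v ≡ 1
      χ≡1 Uv rewrite Uv = refl

      y≡y′ : ∀ {v} → U v ≡ true → y v ≡ y′ v
      y≡y′ Uv rewrite Uv = refl

      y′-paired : ∀ {v} → ∃ (Partner v) → y′ v ≡ 1 ∸ (𝟙 (hit? v) ∸ 𝟙 (partnerHit? v))
      y′-paired {v} p with partner? v
      ... | yes _ = refl
      ... | no ¬p = contradiction p ¬p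

      y′-single : ∀ {v} → Single v → y′ v ≡ 2 ∸ 𝟙 (any? (triangle? v))
      y′-single {v} (_ , ¬p) with partner? v
      ... | yes p = contradiction p ¬p
      ... | no _  = refl

      -- A third vertex would put three vertices of `U` into the closed neighbourhood of the centre
      -- of the part.
      two-in-part : ∀ {a b v} → U a ≡ true → Partner a b → U v ≡ true → c v ≡ c a → v ≡ a ⊎ v ≡ b
      two-in-part {a} {b} {v} Ua (b≢a , Ub , cb≡ca) Uv cv≡ca with v ≟ a | v ≟ b
      ... | yes v≡a | _       = inj₁ v≡a
      ... | no _    | yes v≡b = inj₂ v≡b
      ... | no v≢a  | no v≢b  = contradiction (≤-trans (three≤N (≢-sym b≢a) (≢-sym v≢a) (≢-sym v≢b)
            (⊲-sym (c-covers a Ua)) (near Ub cb≡ca) (near Uv cv≡ca) (one Ua) (one Ub) (one Uv)) (N≤2 (centre (c a)))) (n≮n 2)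
        where
        near : ∀ {w} → U w ≡ true → c w ≡ c a → centre (c a) ⊲ w
        near Uw cw≡ca = ⊲-sym (subst (λ j → _ ⊲ centre j) cw≡ca (c-covers _ Uw))
        one : ∀ {w} → U w ≡ true → 1 ≤ χ U w
        one Uw = ≤-reflexive (sym (χ≡1 Uw))

      alone : ∀ {x v} → Single x → U v ≡ true → c v ≡ c x → v ≡ x
      alone {x} {v} (_ , ¬p) Uv cv≡cx with v ≟ x
      ... | yes v≡x = v≡x
      ... | no v≢x  = contradiction (v , v≢x , Uv , cv≡cx) ¬p

      single≉single : ∀ {x v} → Single x → Single v → x ≢ v → ¬ x ≈ v
      single≉single {x} {v} sx@(Ux , _) sv x≢v (u , x⊲u , v⊲u) =
        exchange₂ u (λ cx≡cv → x≢v (alone sv Ux cx≡cv)) λ where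
          w Uw (inj₁ cw≡cx) → subst (_⊲ u) (sym (alone sx Uw cw≡cx)) x⊲u
          w Uw (inj₂ cw≡cv) → subst (_⊲ u) (sym (alone sv Uw cw≡cv)) v⊲u

      single≢part : ∀ {x a b} → Single x → U a ≡ true → Partner a b → c x ≢ c a
      single≢part sx Ua p cx≡ca with alone sx Ua (sym cx≡ca)
      ... | refl = proj₂ sx (_ , p)

      -- Different singles at the two ends of a pair would be an augmenting path: `u` serves `x` and
      -- `a`, `u′` serves `x′` and `b`, and one of the three parts is saved.
      one-hitter : ∀ {a b x x′} → U a ≡ true → Partner a b → Single x → x ≈ a → Single x′ → x′ ≈ b → x ≡ x′
      one-hitter {a} {b} {x} {x′} Ua p sx (u , x⊲u , a⊲u) sx′ (u′ , x′⊲u′ , b⊲u′) with x ≟ x′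
      ... | yes x≡x′ = x≡x′
      ... | no x≢x′  = contradiction covered
        (exchange₃ u u′ (λ cx≡cx′ → x≢x′ (alone sx′ (proj₁ sx) cx≡cx′)) (single≢part sx Ua p) (single≢part sx′ Ua p))
        where
        covered : ∀ v → U v ≡ true → c v ≡ c x ⊎ c v ≡ c x′ ⊎ c v ≡ c a → v ⊲ u ⊎ v ⊲ u′
        covered v Uv (inj₁ eq) = inj₁ (subst (_⊲ u) (sym (alone sx Uv eq)) x⊲u)
        covered v Uv (inj₂ (inj₁ eq)) = inj₂ (subst (_⊲ u′) (sym (alone sx′ Uv eq)) x′⊲u′)
        covered v Uv (inj₂ (inj₂ eq)) with two-in-part Ua p Uv eq
        ... | inj₁ refl = inj₁ a⊲u
        ... | inj₂ refl = inj₂ b⊲u′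

      y-support : ∀ v → U v ≡ false → y v ≡ 0
      y-support v ¬Uv rewrite ¬Uv = refl

      y≤2 : ∀ v → y v ≤ 2
      y≤2 v with U v
      ... | false = z≤n
      ... | true with does (partner? v)
      ...   | true  = ≤-trans (m∸n≤m 1 (𝟙 (hit? v) ∸ 𝟙 (partnerHit? v))) (s≤s z≤n)
      ...   | false = m∸n≤m 2 (𝟙 (any? (triangle? v)))

      y≡2⇒single : ∀ {x} → 2 ≤ y x → Single x × ¬ ∃ (Triangle x)
      y≡2⇒single {x} 2≤y = case U x Bool.≟ true of λ where
        (no ¬Ux) → contradiction (subst (2 ≤_) (y-support x (Bool.¬-not ¬Ux)) 2≤y) λ ()
        (yes Ux) → case partner? x of λ where
          (yes p) → contradiction (≤-trans (subst (2 ≤_) (trans (y≡y′ Ux) (y′-paired p)) 2≤y)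
            (m∸n≤m 1 (𝟙 (hit? x) ∸ 𝟙 (partnerHit? x)))) (n≮n 1)
          (no ¬p) → (Ux , ¬p) , λ t → contradiction
            (subst (2 ≤_) (trans (y≡y′ Ux) (trans (y′-single (Ux , ¬p))
              (cong (2 ∸_) (𝟙-yes (any? (triangle? x)) t)))) 2≤y) (n≮n 1)

      -- If no vertex near `u` has value 2, then `y` is at most `χ U` there. If `x` has value 2, it
      -- is a single in no triangle. Any other vertex of `U` near `u` is then paired and hit by `x`,
      -- and its partner is not hit: by `one-hitter` the hitter would be `x`, giving a triangle. So
      -- it has value 0.
      Ny≤2 : ∀ u → N u y ≤ 2
      Ny≤2 u with any? (λ x → (u ⊲? x) ×-dec (2 ≤? y x))
      ... | no ¬heavy = ≤-trans (N-mono u λ {v} u⊲v → light v u⊲v) (N≤2 u)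
        where
        light : ∀ v → u ⊲ v → y v ≤ χ U v
        light v u⊲v = case U v Bool.≟ true of λ where
          (yes Uv) → subst (y v ≤_) (sym (χ≡1 Uv)) (≤-pred (≰⇒> λ 2≤y → ¬heavy (v , u⊲v , 2≤y)))
          (no ¬Uv) → subst (_≤ χ U v) (sym (y-support v (Bool.¬-not ¬Uv))) z≤n
      ... | yes (x , u⊲x , 2≤y) = ≤-trans (N-mono u λ {v} u⊲v → only-x v u⊲v) (≤-reflexive (N-δ u⊲x 2))
        where
        sx = proj₁ (y≡2⇒single 2≤y)
        others : ∀ v → u ⊲ v → v ≢ x → U v ≡ true → y v ≡ 0
        others v u⊲v v≢x Uv = go (partner? v)
          where
          x≈v : x ≈ v
          x≈v = u , ⊲-sym u⊲x , ⊲-sym u⊲v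
          ¬partnerHit : ¬ PartnerHit v
          ¬partnerHit (b , p , x′ , sx′ , x′≈b) with one-hitter Uv p sx x≈v sx′ x′≈b
          ... | refl = proj₂ (y≡2⇒single 2≤y) (c v , v , b , (Uv , refl) , p , x≈v , x′≈b)
          go : Dec (∃ (Partner v)) → y v ≡ 0
          go (no ¬p) = contradiction x≈v (single≉single sx (Uv , ¬p) (≢-sym v≢x))
          go (yes p) = trans (y≡y′ Uv) (trans (y′-paired p) (cong₂ (λ h h′ → 1 ∸ (h ∸ h′))
            (𝟙-yes (hit? v) (x , sx , x≈v)) (𝟙-no (partnerHit? v) ¬partnerHit)))
        only-x : ∀ v → u ⊲ v → y v ≤ 2 * 𝟙 (v ≟ x)
        only-x v u⊲v with v ≟ x
        ... | yes _  = y≤2 v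
        ... | no v≢x = case U v Bool.≟ true of λ where
          (yes Uv) → ≤-reflexive (others v u⊲v v≢x Uv)
          (no ¬Uv) → ≤-reflexive (y-support v (Bool.¬-not ¬Uv))

      TrianglePart : Fin m → Fin m → Set
      TrianglePart i j = ∃ λ x → (Single x × c x ≡ i) × Triangle x j

      abstract
        trianglePart? : ∀ i j → Dec (TrianglePart i j)
        trianglePart? i j = any? λ x → (single? x ×-dec (c x ≟ i)) ×-dec triangle? x j

      -- By `one-hitter` a single that hits both vertices of a pair is the only one to hit either,
      -- so each pair is in a triangle with at most one single. The cases are the two orders in
      -- which the pair may be listed.
      trianglePart-functional : ∀ {i i′ j} → TrianglePart i j → TrianglePart i′ j → i ≡ i′
      trianglePart-functional (x , (sx , cx≡i) , a , b , (Ua , ca≡j) , p , x≈a , x≈b)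
                   (x′ , (sx′ , cx′≡i′) , a′ , b′ , (Ua′ , ca′≡j) , (b′≢a′ , Ub′ , cb′≡ca′) , x′≈a′ , x′≈b′) =
        trans (sym cx≡i) (trans (cong c x≡x′) cx′≡i′)
        where
        x≡x′ : x ≡ x′
        x≡x′ with two-in-part Ua p Ua′ (trans ca′≡j (sym ca≡j))
        ... | inj₂ refl = one-hitter Ua p sx x≈a sx′ x′≈a′
        ... | inj₁ refl with two-in-part Ua p Ub′ (trans cb′≡ca′ (trans ca′≡j (sym ca≡j)))
        ...   | inj₂ refl = one-hitter Ua p sx x≈a sx′ x′≈b′
        ...   | inj₁ b′≡a = contradiction b′≡a b′≢a′

      part-value : V → ℕ
      part-value v = χ U v + y v

      nonempty : ∀ j → ∃ λ v → U v ≡ true × c v ≡ j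
      nonempty j with any? (λ v → (U v Bool.≟ true) ×-dec (c v ≟ j))
      ... | yes ne = ne
      ... | no ¬ne = contradiction (λ v Uv cv≡j → contradiction (v , Uv , cv≡j) ¬ne) (exchange₁ j)

      in-part : Fin m → V → ℕ
      in-part j v = 𝟙 (c v ≟ j) * part-value v

      in-part≡ : ∀ {j v} → U v ≡ true → c v ≡ j → in-part j v ≡ 1 + y′ v
      in-part≡ {j} {v} Uv cv≡j = trans (cong (_* part-value v) (𝟙-yes (c v ≟ j) cv≡j))
        (trans (+-identityʳ _) (cong₂ _+_ (χ≡1 Uv) (y≡y′ Uv)))

      -- A single contributes 1 + 2 and a pair at least 2 + 1. A single in a triangle lacks one
      -- unit, added on the right; a pair in a triangle has one to spare, added on the left. Over
      -- all parts the lack is at most the surplus, by `trianglePart-functional`.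
      3≤part : ∀ j → 3 + 𝟙 (any? (λ i → trianglePart? i j)) ≤ sum (in-part j) + 𝟙 (any? (trianglePart? j))
      3≤part j with nonempty j
      ... | v , Uv , refl = go (partner? v)
        where
        open ≤-Reasoning
        σ = 𝟙 (any? (λ i → trianglePart? i j))
        τ = 𝟙 (any? (trianglePart? j))
        go : Dec (∃ (Partner v)) → 3 + σ ≤ sum (in-part j) + τ
        go (no ¬p) = begin
          3 + σ                        ≡⟨ cong (3 +_) (𝟙-no (any? (λ i → trianglePart? i j)) ¬triangle) ⟩
          1 + 2                        ≤⟨ +-monoʳ-≤ 1 (m≤n+m∸n 2 t) ⟩
          1 + (t + (2 ∸ t))            ≡⟨ cong suc (+-comm t (2 ∸ t)) ⟩
          1 + (2 ∸ t) + t              ≡⟨ cong (_+ t) (trans (in-part≡ Uv refl) (cong suc (y′-single (Uv , ¬p)))) ⟨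
          in-part j v + t              ≤⟨ +-mono-≤ (term≤sum (in-part j) v) (𝟙-mono (any? (triangle? v)) (any? (trianglePart? j)) (λ { (j′ , tr) → j′ , v , ((Uv , ¬p) , refl) , tr })) ⟩
          sum (in-part j) + τ          ∎
          where
          t = 𝟙 (any? (triangle? v))
          ¬triangle : ¬ ∃ (λ i → TrianglePart i j)
          ¬triangle (_ , _ , _ , _ , _ , (Ua , ca≡j) , p , _) = single≢part (Uv , ¬p) Ua p (sym ca≡j)
        go (yes (b , p@(b≢v , Ub , cb≡cv))) = begin
          3 + σ                                  ≤⟨ +-monoʳ-≤ 2 (pair (any? (λ i → trianglePart? i j))) ⟩
          2 + (y′ v + y′ b)                      ≡⟨ cong suc (+-suc (y′ v) (y′ b)) ⟨
          (1 + y′ v) + (1 + y′ b)                ≡⟨ cong₂ _+_ (in-part≡ Uv refl) (in-part≡ Ub cb≡cv) ⟨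
          in-part j v + in-part j b              ≤⟨ two-terms≤sum (in-part j) (≢-sym b≢v) ⟩
          sum (in-part j)                        ≤⟨ m≤m+n _ _ ⟩
          sum (in-part j) + τ                    ∎
          where
          p′ : Partner b v
          p′ = ≢-sym b≢v , Uv , sym cb≡cv
          h = 𝟙 (hit? v)
          h′ = 𝟙 (hit? b)
          only : ∀ {a b} → U a ≡ true → Partner a b → 𝟙 (partnerHit? a) ≡ 𝟙 (hit? b)
          only {a} {b} Ua p = 𝟙-cong (partnerHit? a) (hit? b) partner-is-b (λ hb → b , p , hb)
            where
            partner-is-b : PartnerHit a → Hit b
            partner-is-b (b′ , (b′≢a , Ub′ , cb′≡ca) , hb′) with two-in-part Ua p Ub′ cb′≡ca
            ... | inj₁ b′≡a = contradiction b′≡a b′≢a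
            ... | inj₂ refl = hb′
          y′v : y′ v ≡ 1 ∸ (h ∸ h′)
          y′v = trans (y′-paired (b , p)) (cong (λ z → 1 ∸ (h ∸ z)) (only Uv p))
          y′b : y′ b ≡ 1 ∸ (h′ ∸ h)
          y′b = trans (y′-paired (v , p′)) (cong (λ z → 1 ∸ (h′ ∸ z)) (only Ub p′))
          hits : ∀ {i} → TrianglePart i j → Hit v × Hit b
          hits (x , (sx , _) , a , a′ , (Ua , ca≡j) , (a′≢a , Ua′ , ca′≡ca) , x≈a , x≈a′)
            with two-in-part Uv p Ua ca≡j | two-in-part Uv p Ua′ (trans ca′≡ca ca≡j)
          ... | inj₁ refl | inj₂ refl = (x , sx , x≈a) , (x , sx , x≈a′)
          ... | inj₂ refl | inj₁ refl = (x , sx , x≈a′) , (x , sx , x≈a)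
          ... | inj₁ refl | inj₁ refl = contradiction refl a′≢a
          ... | inj₂ refl | inj₂ refl = contradiction refl a′≢a
          pair : (t? : Dec (∃ λ i → TrianglePart i j)) → 1 + 𝟙 t? ≤ y′ v + y′ b
          pair (yes (_ , tr)) with hv , hb ← hits tr = ≤-reflexive (sym (cong₂ _+_
            (trans y′v (cong₂ (λ h h′ → 1 ∸ (h ∸ h′)) (𝟙-yes (hit? v) hv) (𝟙-yes (hit? b) hb)))
            (trans y′b (cong₂ (λ h h′ → 1 ∸ (h ∸ h′)) (𝟙-yes (hit? b) hb) (𝟙-yes (hit? v) hv)))))
          -- Not both vertices can be hit without their partner being hit, so one of them keeps its
          -- unit.
          pair (no _) with ≤-total h h′
          ... | inj₁ h≤h′ = ≤-trans (≤-reflexive (sym (trans y′v (cong (1 ∸_) (m≤n⇒m∸n≡0 h≤h′))))) (m≤m+n _ _)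
          ... | inj₂ h′≤h = ≤-trans (≤-reflexive (sym (trans y′b (cong (1 ∸_) (m≤n⇒m∸n≡0 h′≤h))))) (m≤n+m _ _)

      3m≤ : 3 * m ≤ sum (χ U) + sum y
      3m≤ = +-cancelʳ-≤ (sum σ) (3 * m) (sum (χ U) + sum y) (begin
        3 * m + sum σ                                ≡⟨ cong (_+ sum σ) (sum-const m 3) ⟨
        sum {m} (λ _ → 3) + sum σ                    ≤⟨ sum-split (λ _ → 3) σ _ 3≤part ⟩
        sum (λ j → sum (in-part j) + τ j)            ≡⟨ ∑-distrib-+ (λ j → sum (in-part j)) τ ⟩
        sum (λ j → sum (in-part j)) + sum τ          ≡⟨ cong (_+ sum τ) (sum-fibres c part-value) ⟨
        sum part-value + sum τ                       ≡⟨ cong (_+ sum τ) (∑-distrib-+ (χ U) y) ⟩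
        sum (χ U) + sum y + sum τ                    ≤⟨ +-monoʳ-≤ (sum (χ U) + sum y) (domain≤codomain trianglePart? trianglePart-functional) ⟩
        sum (χ U) + sum y + sum σ                    ∎)
        where
        open ≤-Reasoning
        σ τ : Fin m → ℕ
        σ j = 𝟙 (any? (λ i → trianglePart? i j))
        τ j = 𝟙 (any? (trianglePart? j))

    cover-and-packing : ∃ λ D → ∃ λ y → Covered U D × (∀ v → U v ≡ false → y v ≡ 0) ×
      (∀ u → N u y ≤ 2) × 3 * length D ≤ sum (χ U) + sum y
    cover-and-packing = go (minCover U)
      where
      go : MinCover U → _
      go record { size = zero ; covers = covers } =
        [] , (λ _ → 0) , (λ v Uv → contradiction (proj₁ (covers v Uv)) λ ()) , (λ _ _ → refl) ,
        (λ u → ≤-trans (≤-reflexive (sum-zero (λ v → *-zeroʳ (𝟙 (u ⊲? v))))) z≤n) , z≤n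
      go M@record { size = suc m ; centre = centre ; covers = covers } =
        List.tabulate centre , y , (λ v Uv → centre (c v) , ∈-tabulate⁺ {f = centre} (c v) , c-covers v Uv) , y-support , Ny≤2 ,
        subst (λ l → 3 * l ≤ sum (χ U) + sum y) (sym (length-tabulate centre)) 3m≤
        where
        assign : ∀ v → ∃ λ j → U v ≡ true → v ⊲ centre j
        assign v with U v in eq
        ... | true  = proj₁ (covers v eq) , λ _ → proj₂ (covers v eq)
        -- Vertices outside `U` go to an arbitrary part, where their `part-value` is 0. This needs a
        -- nonempty index set, hence the separate case of size zero.
        ... | false = zero , λ ()
        c : V → Fin (suc m)
        c v = proj₁ (assign v)
        c-covers : ∀ v → U v ≡ true → v ⊲ centre (c v)
        c-covers v = proj₂ (assign v)
        open Parts M c c-covers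

-- Partitions of the vertices into stars around the centres of a minimum cover.

module StarPartitions (F : Graph) (M : MinimumCovers.MinCover F (λ _ → true)) where
  open Graph F using (Adj; adj?; irrefl) renaming (sym to adj-sym)
  open Neighbourhoods F
  open MinimumCovers F

  private
    V = Vertex F

  Isolated : V → Set
  Isolated v = ∀ u → ¬ Adj v u

  isolated? : ∀ v → Dec (Isolated v)
  isolated? v = all? λ u → ¬? (adj? v u)

  open MinCover M renaming (size to m)

  γ≤m : γ F ≤ m
  γ≤m = ≤-trans
    (γ≤length (List.tabulate centre) λ v →
      let j , v⊲ = covers v refl in centre j , ∈-tabulate⁺ {f = centre} j , v⊲)
    (≤-reflexive (length-tabulate centre))

  -- A repeated centre would make one of its indices redundant. This is what allows each centre to
  -- be assigned to its own part.
  centre-injective : ∀ {i j} → centre i ≡ centre j → i ≡ j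
  centre-injective {i} {j} eq with i ≟ j
  ... | yes i≡j = i≡j
  ... | no i≢j  = contradiction covered (minimal centre i)
    where
    covered : ∀ v → true ≡ true → ∃ λ l → l ≢ i × v ⊲ centre l
    covered v _ with covers v refl
    ... | l , v⊲ with l ≟ i
    ...   | yes refl = j , ≢-sym i≢j , subst (v ⊲_) eq v⊲
    ...   | no l≢i   = l , l≢i , v⊲

  -- Because of `c-centre`, a part with a leaf has at least two vertices and a leafless part is its
  -- centre alone.
  record Assignment : Set where
    field
      c        : V → Fin m
      c-covers : ∀ v → v ⊲ centre (c v)
      c-centre : ∀ j → c (centre j) ≡ j

    Leaf : Fin m → V → Set
    Leaf j w = c w ≡ j × w ≢ centre j

    leaf? : ∀ j → Dec (∃ (Leaf j))
    leaf? j = any? λ w → (c w ≟ j) ×-dec ¬? (w ≟ centre j)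

    only-centre : ∀ {j} → ¬ ∃ (Leaf j) → ∀ {w} → c w ≡ j → w ≡ centre j
    only-centre {j} ¬leaf {w} cw≡j with w ≟ centre j
    ... | yes eq = eq
    ... | no neq = contradiction (w , cw≡j , neq) ¬leaf

  open Assignment

  firstAssignment : Assignment
  firstAssignment = record { c = proj₁ ∘ assign ; c-covers = proj₁ ∘ proj₂ ∘ assign ; c-centre = λ j → proj₂ (proj₂ (assign (centre j))) j refl }
    where
    assign : ∀ v → ∃ λ j → v ⊲ centre j × (∀ i → v ≡ centre i → j ≡ i)
    assign v with any? (λ j → v ≟ centre j)
    ... | yes (j , v≡) = j , inj₁ v≡ , λ i v≡′ → centre-injective (trans (sym v≡) v≡′)
    ... | no ¬centre   = let j , v⊲ = covers v refl in j , v⊲ , λ i v≡ → contradiction (i , v≡) ¬centre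

  leafless : Assignment → ℕ
  leafless A = sum (λ j → 𝟙 (¬? (leaf? A j)))

  -- A leafless centre with a neighbour u can take over u: u is not a centre, and the part losing u
  -- keeps another leaf, since otherwise u alone would dominate both parts.
  steal : ∀ A {j u} → ¬ ∃ (Leaf A j) → Adj (centre j) u → ∃ λ A′ → leafless A′ < leafless A
  steal A {j} {u} ¬leaf adj = A′ , sum-mono-< (λ k → 𝟙-mono (¬? (leaf? A′ k)) (¬? (leaf? A k)) (keeps-leaf k)) j strict
    where
    open Exchange M (c A) (λ v _ → c-covers A v)
    u≢j : u ≢ centre j
    u≢j u≡ = irrefl (sym u≡) adj
    u≢centre : ∀ i → u ≢ centre i
    u≢centre i u≡ = exchange₁ j λ v _ cv≡j → i , (λ { refl → u≢j u≡ }) ,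
      inj₂ (subst₂ Adj (sym (only-centre A ¬leaf cv≡j)) u≡ adj)
    c′ = c A [ u ≔ j ]
    c′-covers : ∀ v → v ⊲ centre (c′ v)
    c′-covers v with v ≟ u
    ... | yes refl = inj₂ (adj-sym adj)
    ... | no _     = c-covers A v
    A′ : Assignment
    A′ = record
      { c        = c′
      ; c-covers = c′-covers
      ; c-centre = λ i → trans (≔-off (c A) j (≢-sym (u≢centre i))) (c-centre A i)
      }
    strict : 𝟙 (¬? (leaf? A′ j)) < 𝟙 (¬? (leaf? A j))
    strict = subst₂ _<_ (sym (𝟙-no (¬? (leaf? A′ j)) (λ ¬l → ¬l (u , ≔-at (c A) u j , u≢j))))
                        (sym (𝟙-yes (¬? (leaf? A j)) ¬leaf)) (s≤s z≤n)
    keeps-leaf : ∀ k → ¬ ∃ (Leaf A′ k) → ¬ ∃ (Leaf A k)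
    keeps-leaf k ¬leaf′ (w , cw≡k , w≢) with w ≟ u
    ... | no w≢u   = ¬leaf′ (w , trans (≔-off (c A) j w≢u) cw≡k , w≢)
    ... | yes refl = exchange₂ u (λ { refl → ¬leaf (u , cw≡k , u≢j) }) dominated
      where
      dominated : ∀ v → true ≡ true → c A v ≡ j ⊎ c A v ≡ k → v ⊲ u
      dominated v _ (inj₁ cv≡j) = inj₂ (subst (λ x → Adj x u) (sym (only-centre A ¬leaf cv≡j)) adj)
      dominated v _ (inj₂ cv≡k) with v ≟ u
      ... | yes refl = ⊲-refl
      ... | no v≢u   = subst (_⊲ u) (sym (only-centre A′ ¬leaf′ (trans (≔-off (c A) j v≢u) cv≡k)))
                         (⊲-sym (subst (λ i → u ⊲ centre i) cw≡k (c-covers A u)))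

  -- Each `steal` lowers the number of leafless parts, so only those with an isolated centre remain
  -- in the end.
  starPartition : ∃ λ A → ∀ j → ¬ ∃ (Leaf A j) → Isolated (centre j)
  starPartition = improve (leafless firstAssignment) firstAssignment ≤-refl
    where
    improve : ∀ fuel A → leafless A ≤ fuel → ∃ λ A → ∀ j → ¬ ∃ (Leaf A j) → Isolated (centre j)
    improve fuel A bound with any? (λ j → ¬? (leaf? A j) ×-dec any? (adj? (centre j)))
    ... | no ¬stealable = A , λ j ¬leaf u adj → ¬stealable (j , ¬leaf , u , adj)
    ... | yes (j , ¬leaf , u , adj) with steal A ¬leaf adj
    ...   | A′ , A′<A with fuel
    ...     | zero    = contradiction (≤-trans A′<A bound) λ ()
    ...     | suc fuel = improve fuel A′ (≤-pred (≤-trans A′<A bound))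

-- Packings from star partitions, for maximum degree at most 3.

module StarPackings (F : Graph) (M : MinimumCovers.MinCover F (λ _ → true))
  (A : StarPartitions.Assignment F M)
  (leafless⇒isolated : ∀ j → ¬ ∃ (StarPartitions.Assignment.Leaf A j) →
    StarPartitions.Isolated F M (MinimumCovers.MinCover.centre M j)) where
  open StarPartitions F M
  open Graph F using (Adj) renaming (sym to adj-sym)
  open Neighbourhoods F
  open MinimumCovers F
  open MinCover M renaming (size to m)
  open Assignment

  private
    V = Vertex F
    part : V → Fin m
    part = c A
    part-covers = c-covers A
  open Exchange M part (λ v _ → part-covers v)

  in-part : (V → ℕ) → Fin m → V → ℕ
  in-part y j v = 𝟙 (part v ≟ j) * y v

  in-part≡ : ∀ y {j v} → part v ≡ j → in-part y j v ≡ y v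
  in-part≡ y {j} {v} eq = trans (cong (_* y v) (𝟙-yes (part v ≟ j) eq)) (+-identityʳ (y v))

  parts⇒sum : ∀ a y → (∀ j → a ≤ sum (in-part y j)) → a * γ F ≤ sum y
  parts⇒sum a y a≤ = begin
    a * γ F                          ≤⟨ *-monoʳ-≤ a γ≤m ⟩
    a * m                            ≡⟨ sum-const m a ⟨
    sum {m} (λ _ → a)                ≤⟨ sum-mono a≤ ⟩
    sum (λ j → sum (in-part y j))    ≡⟨ sum-fibres part y ⟨
    sum y                            ∎
    where open ≤-Reasoning

  isolated-N : ∀ {u} y → Isolated u → N u y ≤ y u
  isolated-N {u} y iso = ≤-trans (N-mono u only-u) (≤-reflexive (N-δ {u} ⊲-refl (y u)))
    where
    only-u : ∀ {v} → u ⊲ v → y v ≤ y u * 𝟙 (v ≟ u)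
    only-u (inj₂ a)    = contradiction a (iso _)
    only-u (inj₁ refl) = ≤-reflexive (sym (trans (cong (y u *_) (𝟙-yes (u ≟ u) refl)) (*-identityʳ (y u))))

  isolated-⊲ : ∀ {u v} → ¬ Isolated u → u ⊲ v → ¬ Isolated v
  isolated-⊲ ¬iso (inj₁ refl) = ¬iso
  isolated-⊲ ¬iso (inj₂ a)    = λ iso → iso _ (adj-sym a)

  -- A weighted form of Ore's bound γ ≤ n/2. An isolated vertex has a second unit in place of the
  -- missing leaf. The ratio (Δ+1)/2 is the harmonic number for Δ = 1 and Δ = 2, but exceeds 11/6
  -- for Δ = 3.
  ore-packing : maxDegree F ≥ 1 → Packing 2 (suc (maxDegree F))
  ore-packing Δ≥1 = y , parts⇒sum 2 y 2≤part , Ny≤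
    where
    y : V → ℕ
    y v = 1 + 𝟙 (isolated? v)
    1≤y : ∀ {j v} → part v ≡ j → 1 ≤ in-part y j v
    1≤y {v = v} eq = subst (1 ≤_) (sym (in-part≡ y eq)) (s≤s z≤n)
    2≤part : ∀ j → 2 ≤ sum (in-part y j)
    2≤part j with leaf? A j
    ... | yes (w , cw≡j , w≢) = ≤-trans (+-mono-≤ (1≤y cw≡j) (1≤y (c-centre A j))) (two-terms≤sum (in-part y j) w≢)
    ... | no ¬leaf = ≤-trans
      (≤-reflexive (sym (trans (in-part≡ y (c-centre A j)) (cong suc (𝟙-yes (isolated? (centre j)) (leafless⇒isolated j ¬leaf))))))
      (term≤sum (in-part y j) (centre j))
    Ny≤ : ∀ u → N u y ≤ suc (maxDegree F)
    Ny≤ u with isolated? u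
    ... | yes iso = ≤-trans (isolated-N y iso) (≤-trans (s≤s (𝟙≤1 (isolated? u))) (s≤s Δ≥1))
    ... | no ¬iso = ≤-trans (N-mono u (λ {v} u⊲v → ≤-reflexive (cong suc (𝟙-no (isolated? v) (isolated-⊲ ¬iso u⊲v))))) (∣N∣≤1+Δ u)

  -- Maximum degree 3: load at most 22 against 12 per part.

  module Subcubic (Δ≤3 : maxDegree F ≤ 3) where

    card : Fin m → ℕ
    card j = sum (λ v → 𝟙 (part v ≟ j))

    Paired : V → Set
    Paired v = card (part v) ≡ 2

    Hit : V → Set
    Hit v = ∃ λ z → Paired z × part z ≢ part v × z ⊲ v

    PartnerHit : V → Set
    PartnerHit v = ∃ λ b → b ≢ v × part b ≡ part v × Hit b

    abstract
      hit? : ∀ v → Dec (Hit v)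
      hit? v = any? λ z → (card (part z) ℕ.≟ 2) ×-dec ¬? (part z ≟ part v) ×-dec (z ⊲? v)

      partnerHit? : ∀ v → Dec (PartnerHit v)
      partnerHit? v = any? λ b → ¬? (b ≟ v) ×-dec (part b ≟ part v) ×-dec hit? b

    -- Each part receives total 12, shared equally except that in a pair one unit moves away from a
    -- vertex adjacent to another pair.
    price : ℕ → V → ℕ
    price 0 v = 3
    price 1 v = 12
    price 2 v = (6 + 𝟙 (partnerHit? v)) ∸ 𝟙 (hit? v)
    price 3 v = 4
    price (suc (suc (suc (suc _)))) v = 3

    y : V → ℕ
    y v = price (card (part v)) v

    y-paired : ∀ {v} → Paired v → y v ≡ (6 + 𝟙 (partnerHit? v)) ∸ 𝟙 (hit? v)
    y-paired {v} eq = cong (λ k → price k v) eq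

    counted : ∀ {j v} → part v ≡ j → 1 ≤ 𝟙 (part v ≟ j)
    counted {j} {v} eq = ≤-reflexive (sym (𝟙-yes (part v ≟ j) eq))

    1≤card : ∀ j → 1 ≤ card j
    1≤card j = ≤-trans (counted (c-centre A j)) (term≤sum (λ v → 𝟙 (part v ≟ j)) (centre j))

    mate : ∀ {v} → ¬ Isolated v → ∃ λ b → b ≢ v × part b ≡ part v × v ⊲ b
    mate {v} ¬iso with v ≟ centre (part v)
    ... | no v≢ = centre (part v) , ≢-sym v≢ , c-centre A (part v) , part-covers v
    ... | yes v≡ with leaf? A (part v)
    ...   | no ¬leaf = contradiction (subst Isolated (sym v≡) (leafless⇒isolated (part v) ¬leaf)) ¬iso
    ...   | yes (w , eq , w≢) = w , (λ w≡v → w≢ (trans w≡v v≡)) , eq ,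
            ⊲-sym (subst (w ⊲_) (trans (cong centre eq) (sym v≡)) (part-covers w))

    card1⇒isolated : ∀ {v} → card (part v) ≡ 1 → Isolated v
    card1⇒isolated {v} eq with isolated? v
    ... | yes iso = iso
    ... | no ¬iso with b , b≢v , pb , _ ← mate ¬iso = contradiction
      (≤-trans (+-mono-≤ (counted pb) (counted refl)) (≤-trans (two-terms≤sum (λ v′ → 𝟙 (part v′ ≟ part v)) b≢v) (≤-reflexive eq))) (n≮n 1)

    paired⇒¬isolated : ∀ {v} → Paired v → ¬ Isolated v
    paired⇒¬isolated {v} pv iso = contradiction
      (≤-trans (≤-reflexive (sym pv)) (≤-trans (sum-mono only-v) (≤-reflexive (sum-𝟙≟ v)))) (n≮n 1)
      where
      isolated-centre : ∀ {w} → w ⊲ v → w ≡ v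
      isolated-centre (inj₁ eq) = eq
      isolated-centre (inj₂ a)  = contradiction (adj-sym a) (iso _)
      v≡centre : v ≡ centre (part v)
      v≡centre = sym (isolated-centre (⊲-sym (part-covers v)))
      only-v : ∀ w → 𝟙 (part w ≟ part v) ≤ 𝟙 (w ≟ v)
      only-v w = 𝟙-mono (part w ≟ part v) (w ≟ v) λ eq →
        isolated-centre (subst (w ⊲_) (trans (cong centre eq) (sym v≡centre)) (part-covers w))

    two-in-part : ∀ {a b v} → Paired a → b ≢ a → part b ≡ part a → part v ≡ part a → v ≡ a ⊎ v ≡ b
    two-in-part {a} {b} {v} pa b≢a eqb eqv with v ≟ a | v ≟ b
    ... | yes v≡a | _       = inj₁ v≡a
    ... | no _    | yes v≡b = inj₂ v≡b
    ... | no v≢a  | no v≢b  = contradiction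
      (≤-trans (+-mono-≤ (+-mono-≤ (counted refl) (counted eqb)) (counted eqv))
        (≤-trans (three-terms≤sum (λ v′ → 𝟙 (part v′ ≟ part a)) (≢-sym b≢a) (≢-sym v≢a) (≢-sym v≢b)) (≤-reflexive pa))) (n≮n 2)

    pair-⊲ : ∀ {v w} → Paired v → part w ≡ part v → w ⊲ v
    pair-⊲ {v} {w} pv eq with b , b≢v , pb , v⊲b ← mate (paired⇒¬isolated pv) with two-in-part pv b≢v pb eq
    ... | inj₁ refl = ⊲-refl
    ... | inj₂ refl = ⊲-sym v⊲b

    partnerHit≡ : ∀ {a b} → Paired a → b ≢ a → part b ≡ part a → 𝟙 (partnerHit? a) ≡ 𝟙 (hit? b)
    partnerHit≡ {a} {b} pa b≢a eqb = 𝟙-cong (partnerHit? a) (hit? b) partner-is-b (λ hb → b , b≢a , eqb , hb)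
      where
      partner-is-b : PartnerHit a → Hit b
      partner-is-b (b′ , b′≢a , eq , hb′) with two-in-part pa b≢a eqb eq
      ... | inj₁ b′≡a = contradiction b′≡a b′≢a
      ... | inj₂ refl = hb′

    pair-sum : ∀ {a b} → Paired a → b ≢ a → part b ≡ part a → y a + y b ≡ 12
    pair-sum {a} {b} pa b≢a eqb = begin
      y a + y b                                                              ≡⟨ cong₂ _+_ (y-paired pa) (y-paired pb) ⟩
      ((6 + 𝟙 (partnerHit? a)) ∸ 𝟙 (hit? a)) + ((6 + 𝟙 (partnerHit? b)) ∸ 𝟙 (hit? b))
        ≡⟨ cong₂ (λ h h′ → ((6 + h) ∸ 𝟙 (hit? a)) + ((6 + h′) ∸ 𝟙 (hit? b))) (partnerHit≡ pa b≢a eqb) (partnerHit≡ pb (≢-sym b≢a) (sym eqb)) ⟩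
      ((6 + 𝟙 (hit? b)) ∸ 𝟙 (hit? a)) + ((6 + 𝟙 (hit? a)) ∸ 𝟙 (hit? b))      ≡⟨ cancel (hit? a) (hit? b) ⟩
      12                                                                     ∎
      where
      open ≡-Reasoning
      pb : Paired b
      pb = trans (cong card eqb) pa
      cancel : {P Q : Set} (P? : Dec P) (Q? : Dec Q) → ((6 + 𝟙 Q?) ∸ 𝟙 P?) + ((6 + 𝟙 P?) ∸ 𝟙 Q?) ≡ 12
      cancel (yes _) (yes _) = refl
      cancel (yes _) (no _)  = refl
      cancel (no _)  (yes _) = refl
      cancel (no _)  (no _)  = refl

    12≤part : ∀ j → 12 ≤ sum (in-part y j)
    12≤part j = go (card j) refl
      where
      const≤ : ∀ b → (∀ {v} → part v ≡ j → b ≤ y v) → b * card j ≤ sum (in-part y j)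
      const≤ b b≤y = ≤-trans (≤-reflexive (*-distribˡ-sum b (λ v → 𝟙 (part v ≟ j))))
        (sum-mono λ v → ≤-trans (≤-reflexive (*-comm b (𝟙 (part v ≟ j)))) (𝟙*-mono (part v ≟ j) b≤y))
      price≤ : ∀ {k v} → card j ≡ k → part v ≡ j → price k v ≤ y v
      price≤ {v = v} eq refl = ≤-reflexive (cong (λ k → price k v) (sym eq))
      go : ∀ k → card j ≡ k → 12 ≤ sum (in-part y j)
      go 0 eq = contradiction (≤-trans (1≤card j) (≤-reflexive eq)) λ ()
      go 1 eq = ≤-trans (≤-reflexive (cong (12 *_) (sym eq))) (const≤ 12 (price≤ eq))
      go 2 eq with mate {centre j} (paired⇒¬isolated (trans (cong card (c-centre A j)) eq))
      ... | b , b≢ , pb , _ = begin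
        12                                          ≡⟨ pair-sum (trans (cong card (c-centre A j)) eq) b≢ pb ⟨
        y (centre j) + y b                          ≡⟨ cong₂ _+_ (in-part≡ y (c-centre A j)) (in-part≡ y (trans pb (c-centre A j))) ⟨
        in-part y j (centre j) + in-part y j b      ≤⟨ two-terms≤sum (in-part y j) (≢-sym b≢) ⟩
        sum (in-part y j)                           ∎
        where open ≤-Reasoning
      go 3 eq = ≤-trans (≤-reflexive (cong (4 *_) (sym eq))) (const≤ 4 (price≤ eq))
      go (suc (suc (suc (suc k)))) eq =
        ≤-trans (*-monoʳ-≤ 3 (s≤s (s≤s (s≤s (s≤s (z≤n {k})))))) (≤-trans (≤-reflexive (cong (3 *_) (sym eq))) (const≤ 3 (price≤ eq)))

    y-unpaired : ∀ {v} → ¬ Isolated v → ¬ Paired v → y v ≤ 4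
    y-unpaired {v} ¬iso ¬paired with card (part v) in eq
    ... | 0 = s≤s (s≤s (s≤s z≤n))
    ... | 1 = contradiction (card1⇒isolated eq) ¬iso
    ... | 2 = contradiction refl ¬paired
    ... | 3 = ≤-refl
    ... | suc (suc (suc (suc _))) = s≤s (s≤s (s≤s z≤n))

    paired? : ∀ v → Dec (Paired v)
    paired? v = card (part v) ℕ.≟ 2

    y≤7 : ∀ {v} → ¬ Isolated v → y v ≤ 7
    y≤7 {v} ¬iso = case paired? v of λ where
      (yes pv) → ≤-trans (≤-reflexive (y-paired pv)) (≤-trans (m∸n≤m (6 + 𝟙 (partnerHit? v)) (𝟙 (hit? v))) (+-monoʳ-≤ 6 (𝟙≤1 (partnerHit? v))))
      (no ¬pv) → ≤-trans (y-unpaired ¬iso ¬pv) (s≤s (s≤s (s≤s (s≤s z≤n))))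

    ∣N∣≤4 : ∀ u → N u (λ _ → 1) ≤ 4
    ∣N∣≤4 u = ≤-trans (∣N∣≤1+Δ u) (s≤s Δ≤3)

    -- Otherwise `z` alone would serve its own pair and the pair of `r`.
    no-full-pair : ∀ {z r r′} → Paired z → Paired r → part r ≢ part z → r′ ≢ r → part r′ ≡ part r → r ⊲ z → ¬ r′ ⊲ z
    no-full-pair {z} {r} {r′} pz pr r≁z r′≢r eq r⊲z r′⊲z = exchange₂ z (≢-sym r≁z) dominated
      where
      dominated : ∀ v → true ≡ true → part v ≡ part z ⊎ part v ≡ part r → v ⊲ z
      dominated v _ (inj₁ pv) = pair-⊲ pz pv
      dominated v _ (inj₂ pv) with two-in-part pr r′≢r eq pv
      ... | inj₁ refl = r⊲z
      ... | inj₂ refl = r′⊲z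

    -- Otherwise z₁ and z₂ would dominate the three pairs.
    one-hitting-pair : ∀ {a b z₁ z₂} → Paired a → b ≢ a → part b ≡ part a → Paired z₁ → part z₁ ≢ part a → z₁ ⊲ a →
      Paired z₂ → part z₂ ≢ part a → z₂ ⊲ b → part z₁ ≡ part z₂
    one-hitting-pair {a} {b} {z₁} {z₂} pa b≢a eqb p₁ z₁≁a z₁⊲a p₂ z₂≁a z₂⊲b with part z₁ ≟ part z₂
    ... | yes eq = eq
    ... | no neq = contradiction dominated (exchange₃ z₁ z₂ neq z₁≁a z₂≁a)
      where
      dominated : ∀ v → true ≡ true → part v ≡ part z₁ ⊎ part v ≡ part z₂ ⊎ part v ≡ part a → v ⊲ z₁ ⊎ v ⊲ z₂
      dominated v _ (inj₁ pv)        = inj₁ (pair-⊲ p₁ pv)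
      dominated v _ (inj₂ (inj₁ pv)) = inj₂ (pair-⊲ p₂ pv)
      dominated v _ (inj₂ (inj₂ pv)) with two-in-part pa b≢a eqb pv
      ... | inj₁ refl = inj₁ (⊲-sym z₁⊲a)
      ... | inj₂ refl = inj₂ (⊲-sym z₂⊲b)

    -- The extremal load is 4 + 4 + 7 + 7. Raising `y` by 3 at `u` and at `b` keeps it within 7 on
    -- the at most four vertices, and 4 * 7 - 6 = 22.
    Ny-large : ∀ {u b} → ¬ Isolated u → b ≢ u → u ⊲ b → y u ≤ 4 → y b ≤ 4 → N u y ≤ 22
    Ny-large {u} {b} ¬iso b≢u u⊲b yu≤4 yb≤4 = +-cancelʳ-≤ 6 (N u y) 22 (begin
      N u y + 6                                        ≡⟨ cong (N u y +_) (cong₂ _+_ (N-δ {u} ⊲-refl 3) (N-δ u⊲b 3)) ⟨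
      N u y + (N u (δ u) + N u (δ b))                  ≡⟨ cong (N u y +_) (N-+ u (δ u) (δ b)) ⟨
      N u y + N u (λ v → δ u v + δ b v)                ≡⟨ N-+ u y (λ v → δ u v + δ b v) ⟨
      N u (λ v → y v + (δ u v + δ b v))                ≤⟨ N-mono u (λ {v} u⊲v → pointwise v u⊲v) ⟩
      N u (λ _ → 7)                                    ≡⟨ N-const u 7 ⟩
      7 * N u (λ _ → 1)                                ≤⟨ *-monoʳ-≤ 7 (∣N∣≤4 u) ⟩
      28                                               ∎)
      where
      open ≤-Reasoning
      δ : V → V → ℕ
      δ a v = 3 * 𝟙 (v ≟ a)
      pointwise : ∀ v → u ⊲ v → y v + (δ u v + δ b v) ≤ 7
      pointwise v u⊲v with v ≟ u | v ≟ b
      ... | yes refl | yes refl = contradiction refl b≢u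
      ... | yes refl | no _     = +-monoˡ-≤ 3 yu≤4
      ... | no _     | yes refl = +-monoˡ-≤ 3 yb≤4
      ... | no _     | no _     = ≤-trans (≤-reflexive (+-identityʳ (y v))) (y≤7 (isolated-⊲ ¬iso u⊲v))

    -- The pair carries 12 and each of the at most two other vertices at most `e + g v`. Adding `e`
    -- at `u` and at `b` lets `e` be counted over all four places without subtraction.
    Ny-pair : ∀ {u b} e (g : V → ℕ) → b ≢ u → u ⊲ b → y u + y b ≡ 12 →
      (∀ {v} → u ⊲ v → v ≢ u → v ≢ b → y v ≤ e + g v) → N u y + 2 * e ≤ 4 * e + N u g + 12
    Ny-pair {u} {b} e g b≢u u⊲b yu+yb≡12 y≤ = begin
      N u y + 2 * e                                           ≡⟨ cong (N u y +_) (trans (cong (λ k → e + k) (+-identityʳ e)) (sym (cong₂ _+_ (N-δ {u} ⊲-refl e) (N-δ u⊲b e)))) ⟩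
      N u y + (N u (δ e u) + N u (δ e b))                     ≡⟨ cong (N u y +_) (N-+ u (δ e u) (δ e b)) ⟨
      N u y + N u (λ v → δ e u v + δ e b v)                   ≡⟨ N-+ u y (λ v → δ e u v + δ e b v) ⟨
      N u (λ v → y v + (δ e u v + δ e b v))                   ≤⟨ N-mono u (λ {v} u⊲v → pointwise v u⊲v) ⟩
      N u (λ v → (e + g v) + (δ (y u) u v + δ (y b) b v))     ≡⟨ N-+ u (λ v → e + g v) (λ v → δ (y u) u v + δ (y b) b v) ⟩
      N u (λ v → e + g v) + N u (λ v → δ (y u) u v + δ (y b) b v)
                                                              ≡⟨ cong₂ _+_ (N-+ u (λ _ → e) g) (trans (N-+ u (δ (y u) u) (δ (y b) b)) (cong₂ _+_ (N-δ {u} ⊲-refl (y u)) (N-δ u⊲b (y b)))) ⟩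
      N u (λ _ → e) + N u g + (y u + y b)                     ≡⟨ cong₂ (λ k l → k + N u g + l) (N-const u e) yu+yb≡12 ⟩
      e * N u (λ _ → 1) + N u g + 12                          ≤⟨ +-monoˡ-≤ 12 (+-monoˡ-≤ (N u g) (≤-trans (*-monoʳ-≤ e (∣N∣≤4 u)) (≤-reflexive (*-comm e 4)))) ⟩
      4 * e + N u g + 12                                      ∎
      where
      open ≤-Reasoning
      δ : ℕ → V → V → ℕ
      δ k a v = k * 𝟙 (v ≟ a)
      pointwise : ∀ v → u ⊲ v → y v + (δ e u v + δ e b v) ≤ (e + g v) + (δ (y u) u v + δ (y b) b v)
      pointwise v u⊲v with v ≟ u | v ≟ b
      ... | yes refl | yes refl = contradiction refl b≢u
      ... | yes refl | no _     rewrite *-zeroʳ e | *-zeroʳ (y b) | *-identityʳ e | *-identityʳ (y u) | +-identityʳ e | +-identityʳ (y u) =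
        ≤-trans (≤-reflexive (+-comm (y u) e)) (+-monoˡ-≤ (y u) (m≤m+n e (g u)))
      ... | no _     | yes refl rewrite *-zeroʳ e | *-zeroʳ (y u) | *-identityʳ e | *-identityʳ (y b) =
        ≤-trans (≤-reflexive (+-comm (y b) e)) (+-monoˡ-≤ (y b) (m≤m+n e (g b)))
      ... | no v≢u   | no v≢b   rewrite *-zeroʳ e | *-zeroʳ (y u) | *-zeroʳ (y b) | +-identityʳ (y v) | +-identityʳ (e + g v) = y≤ u⊲v v≢u v≢b

    -- The pair of `u` carries 12, which leaves 10 for two vertices. If one of them, `r`, has price
    -- above 5, then the pairs of `u` and `r` form a square, the price of `r` is 6, and the fourth
    -- vertex is unpaired, hence has price at most 4.
    Ny-paired : ∀ {u} → Paired u → N u y ≤ 22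
    Ny-paired {u} pu with mate (paired⇒¬isolated pu)
    ... | b , b≢u , pb , u⊲b = go (any? λ r → (u ⊲? r) ×-dec ¬? (r ≟ u) ×-dec ¬? (r ≟ b) ×-dec (6 ≤? y r))
      where
      open ≤-Reasoning
      ¬iso : ¬ Isolated u
      ¬iso = paired⇒¬isolated pu
      pairb : Paired b
      pairb = trans (cong card pb) pu
      other-part : ∀ {v} → v ≢ u → v ≢ b → part v ≢ part u
      other-part v≢u v≢b eq with two-in-part pu b≢u pb eq
      ... | inj₁ v≡u = v≢u v≡u
      ... | inj₂ v≡b = v≢b v≡b
      heavy⇒paired : ∀ {v} → u ⊲ v → 5 ≤ y v → Paired v
      heavy⇒paired {v} u⊲v 5≤y = case paired? v of λ where
        (yes pv) → pv
        (no ¬pv) → contradiction (≤-trans 5≤y (y-unpaired (isolated-⊲ ¬iso u⊲v) ¬pv)) (n≮n 4)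
      go : Dec (∃ λ r → u ⊲ r × r ≢ u × r ≢ b × 6 ≤ y r) → N u y ≤ 22
      go (no ¬heavy) = +-cancelʳ-≤ 10 (N u y) 22 (begin
        N u y + 10                      ≤⟨ Ny-pair 5 (λ _ → 0) b≢u u⊲b (pair-sum pu b≢u pb) (λ u⊲v v≢u v≢b → ≤-pred (≰⇒> λ 6≤y → ¬heavy (_ , u⊲v , v≢u , v≢b , 6≤y))) ⟩
        20 + N u (λ _ → 0) + 12         ≡⟨ cong (λ k → 20 + k + 12) (N-const u 0) ⟩
        32                              ∎)
      go (yes (r , u⊲r , r≢u , r≢b , 6≤yr)) = +-cancelʳ-≤ 8 (N u y) 22 (begin
        N u y + 8                             ≤⟨ Ny-pair 4 (λ v → 2 * 𝟙 (v ≟ r)) b≢u u⊲b (pair-sum pu b≢u pb) light ⟩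
        16 + N u (λ v → 2 * 𝟙 (v ≟ r)) + 12   ≡⟨ cong (λ k → 16 + k + 12) (N-δ u⊲r 2) ⟩
        30                                    ∎)
        where
        pr : Paired r
        pr = heavy⇒paired u⊲r (≤-trans (n≤1+n 5) 6≤yr)
        r≁u : part r ≢ part u
        r≁u = other-part r≢u r≢b
        hit-r : 𝟙 (hit? r) ≡ 1
        hit-r = 𝟙-yes (hit? r) (u , pu , ≢-sym r≁u , u⊲r)
        yr≡ : y r ≡ 5 + 𝟙 (partnerHit? r)
        yr≡ = trans (y-paired pr) (cong ((6 + 𝟙 (partnerHit? r)) ∸_) hit-r)
        yr≤6 : y r ≤ 6
        yr≤6 = ≤-trans (≤-reflexive yr≡) (+-monoʳ-≤ 5 (𝟙≤1 (partnerHit? r)))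
        -- The pair of `r` is hit from one pair only, that of `u`; and `u` itself cannot be next to
        -- `r′` by `no-full-pair`.
        z-is-b : ∀ {r′ z} → r′ ≢ r → part r′ ≡ part r → Paired z → part z ≢ part r′ → z ⊲ r′ → b ⊲ r′
        z-is-b {r′} {z} r′≢r eq pz z≁r′ z⊲r′
          with two-in-part pu b≢u pb (sym (one-hitting-pair pr r′≢r eq pu (≢-sym r≁u) u⊲r pz (λ e → z≁r′ (trans e (sym eq))) z⊲r′))
        ... | inj₁ refl = contradiction (⊲-sym z⊲r′) (no-full-pair pu pr r≁u r′≢r eq (⊲-sym u⊲r))
        ... | inj₂ refl = z⊲r′
        square : ∃ λ r′ → r′ ≢ r × part r′ ≡ part r × r′ ⊲ b
        square = case partnerHit? r of λ where
          (no ¬ph) → contradiction (≤-trans 6≤yr (≤-reflexive (trans yr≡ (cong (5 +_) (𝟙-no (partnerHit? r) ¬ph))))) (n≮n 5)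
          (yes (r′ , r′≢r , eq , z , pz , z≁r′ , z⊲r′)) → r′ , r′≢r , eq , ⊲-sym (z-is-b r′≢r eq pz z≁r′ z⊲r′)
        -- A paired `v` hits `u` while `r′` hits `b`, so `v` would lie in the pair of `r`, and `u`
        -- would dominate that whole pair.
        unpaired : ∀ {v} → u ⊲ v → v ≢ u → v ≢ b → v ≢ r → ¬ Paired v
        unpaired {v} u⊲v v≢u v≢b v≢r pv with square
        ... | r′ , r′≢r , eq , r′⊲b with part v ≟ part r
        ...   | no v≁r = v≁r (trans (one-hitting-pair pu b≢u pb pv (other-part v≢u v≢b) (⊲-sym u⊲v)
                  (trans (cong card eq) pr) (λ e → r≁u (trans (sym eq) e)) r′⊲b) eq)
        ...   | yes v~r = no-full-pair pu pr r≁u v≢r v~r (⊲-sym u⊲r) (⊲-sym u⊲v)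
        light : ∀ {v} → u ⊲ v → v ≢ u → v ≢ b → y v ≤ 4 + 2 * 𝟙 (v ≟ r)
        light {v} u⊲v v≢u v≢b with v ≟ r
        ... | yes refl = yr≤6
        ... | no v≢r   = y-unpaired (isolated-⊲ ¬iso u⊲v) (unpaired u⊲v v≢u v≢b v≢r)

    subcubic-packing : Packing 12 22
    subcubic-packing = y , parts⇒sum 12 y 12≤part , Ny≤22
      where
      y≤12 : ∀ v → y v ≤ 12
      y≤12 v = go (card (part v)) refl
        where
        go : ∀ k → card (part v) ≡ k → y v ≤ 12
        go 2 eq = ≤-trans (y≤7 (paired⇒¬isolated eq)) (m≤m+n 7 5)
        go 0 eq = ≤-trans (≤-reflexive (cong (λ k → price k v) eq)) (m≤m+n 3 9)
        go 1 eq = ≤-reflexive (cong (λ k → price k v) eq)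
        go 3 eq = ≤-trans (≤-reflexive (cong (λ k → price k v) eq)) (m≤m+n 4 8)
        go (suc (suc (suc (suc _)))) eq = ≤-trans (≤-reflexive (cong (λ k → price k v) eq)) (m≤m+n 3 9)
      Ny≤22 : ∀ u → N u y ≤ 22
      Ny≤22 u = case isolated? u of λ where
        (yes iso) → ≤-trans (isolated-N y iso) (≤-trans (y≤12 u) (m≤m+n 12 10))
        (no ¬iso) → case paired? u of λ where
          (yes pu) → Ny-paired pu
          (no ¬pu) → let b , b≢u , pb , u⊲b = mate ¬iso in
            Ny-large ¬iso b≢u u⊲b (y-unpaired ¬iso ¬pu)
              (y-unpaired (isolated-⊲ ¬iso u⊲b) (λ pairb → ¬pu (trans (cong card (sym pb)) pairb)))

-- Greedy covers, and their estimate when the last stages use a minimum cover.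

module Greedy (F : Graph) where
  open Neighbourhoods F
  open MinimumCovers F

  private
    V = Vertex F

  CoveredUpTo : (V → Bool) → (V → Bool) → List V → Set
  CoveredUpTo U U′ D = ∀ v → U v ≡ true → U′ v ≡ true ⊎ ∃ λ d → d ∈ₗ D × v ⊲ d

  -- Each pick dominates at least `suc i` new vertices, so the number of undominated ones serves as
  -- fuel. The size estimate retains `sum (χ U′)`, since consecutive stages are linked through it.
  greedy : ∀ i U → ∃ λ D → ∃ λ U′ → (∀ v → U′ v ≡ true → U v ≡ true) × (∀ u → N u (χ U′) ≤ i) ×
    suc i * length D + sum (χ U′) ≤ sum (χ U) × CoveredUpTo U U′ D
  greedy i U = go (sum (χ U)) U ≤-refl
    where
    go : ∀ fuel U → sum (χ U) ≤ fuel → ∃ λ D → ∃ λ U′ → (∀ v → U′ v ≡ true → U v ≡ true) ×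
      (∀ u → N u (χ U′) ≤ i) × suc i * length D + sum (χ U′) ≤ sum (χ U) × CoveredUpTo U U′ D
    go fuel U bound with any? (λ u → suc i ≤? N u (χ U))
    ... | no ¬big = [] , U , (λ v Uv → Uv) , (λ u → ≤-pred (≰⇒> (λ i<N → ¬big (u , i<N)))) ,
                    ≤-reflexive (cong (_+ sum (χ U)) (*-zeroʳ (suc i))) , λ v Uv → inj₁ Uv
    ... | yes (p , i<N) = pick fuel bound
      where
      U₁ : V → Bool
      U₁ v = U v ∧ not (does (p ⊲? v))
      U₁⊆U : ∀ v → U₁ v ≡ true → U v ≡ true
      U₁⊆U v eq with U v
      ... | true = refl
      pointwise : ∀ v → χ U₁ v + 𝟙 (p ⊲? v) * χ U v ≤ χ U v
      pointwise v with U v | does (p ⊲? v)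
      ... | true  | true  = ≤-refl
      ... | true  | false = ≤-refl
      ... | false | true  = ≤-refl
      ... | false | false = ≤-refl
      drop : suc i + sum (χ U₁) ≤ sum (χ U)
      drop = ≤-trans (≤-reflexive (+-comm (suc i) (sum (χ U₁))))
               (≤-trans (+-monoʳ-≤ (sum (χ U₁)) i<N) (sum-split (χ U₁) _ (χ U) pointwise))
      still : ∀ v → U v ≡ true → ¬ p ⊲ v → U₁ v ≡ true
      still v Uv ¬p⊲v = cong₂ _∧_ Uv (cong not (dec-false (p ⊲? v) ¬p⊲v))
      pick : ∀ fuel → sum (χ U) ≤ fuel → _
      pick zero       bound = contradiction (≤-trans drop bound) λ ()
      pick (suc fuel) bound with go fuel U₁ (≤-pred (≤-trans (+-monoˡ-≤ (sum (χ U₁)) (s≤s (z≤n {i}))) (≤-trans drop bound)))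
      ... | D , U′ , U′⊆U₁ , N≤ , size , covered =
        p ∷ D , U′ , (λ v → U₁⊆U v ∘ U′⊆U₁ v) , N≤ , size′ , covered′
        where
        size′ : suc i * suc (length D) + sum (χ U′) ≤ sum (χ U)
        size′ = begin
          suc i * suc (length D) + sum (χ U′)          ≡⟨ cong (_+ sum (χ U′)) (*-suc (suc i) (length D)) ⟩
          suc i + suc i * length D + sum (χ U′)        ≡⟨ +-assoc (suc i) (suc i * length D) (sum (χ U′)) ⟩
          suc i + (suc i * length D + sum (χ U′))      ≤⟨ +-monoʳ-≤ (suc i) size ⟩
          suc i + sum (χ U₁)                           ≤⟨ drop ⟩
          sum (χ U)                                    ∎
          where open ≤-Reasoning
        covered′ : CoveredUpTo U U′ (p ∷ D)
        covered′ v Uv = case p ⊲? v of λ where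
          (yes p⊲v) → inj₂ (p , here refl , ⊲-sym p⊲v)
          (no ¬p⊲v) → case covered v (still v Uv ¬p⊲v) of λ where
            (inj₁ U′v)            → inj₁ U′v
            (inj₂ (d , d∈ , v⊲d)) → inj₂ (d , there d∈ , v⊲d)

  covered-++ : ∀ {U U′ D D′} → CoveredUpTo U U′ D → Covered U′ D′ → Covered U (D ++ D′)
  covered-++ {D = D} covered covered′ v Uv with covered v Uv
  ... | inj₂ (d , d∈ , v⊲d) = d , ∈-++⁺ˡ d∈ , v⊲d
  ... | inj₁ U′v with d , d∈ , v⊲d ← covered′ v U′v = d , ∈-++⁺ʳ D d∈ , v⊲d

  -- excess j = (3 + j)! (H (3 + j) - 7/6), see excess≡.
  excess : ℕ → ℕ
  excess zero    = 4
  excess (suc j) = (3 + j) ! + (4 + j) * excess j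

  private
    -- One step of Abel summation. The hypotheses give k(t+d) ≤ ku/r + (b/(ra))w; splitting 1/r into
    -- 1/(r+1) + 1/(r(r+1)) and using ku ≤ rw on the second piece adds w/(r+1). So duality is
    -- applied stage by stage, without writing down one combined packing.
    chain-step : ∀ r a b w k t d u u′ → r * a * (k * d) ≤ a * (k * u′) + b * w → r * t + u′ ≤ u → k * u ≤ r * w →
      suc r * (r * a) * (k * (t + d)) ≤ r * a * (k * u) + (r * a + suc r * b) * w
    chain-step r a b w k t d u u′ ih size duality = begin
      suc r * (r * a) * (k * (t + d))                            ≡⟨ split r a k t d ⟩
      suc r * (a * k * (r * t) + r * a * (k * d))                ≤⟨ *-monoʳ-≤ (suc r) (+-monoʳ-≤ (a * k * (r * t)) ih) ⟩
      suc r * (a * k * (r * t) + (a * (k * u′) + b * w))         ≡⟨ collect r a b w k t u′ ⟩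
      suc r * (a * k * (r * t + u′) + b * w)                     ≤⟨ *-monoʳ-≤ (suc r) (+-monoˡ-≤ (b * w) (*-monoʳ-≤ (a * k) size)) ⟩
      suc r * (a * k * u + b * w)                                ≡⟨ peel r a b w k u ⟩
      r * a * (k * u) + a * (k * u) + suc r * b * w              ≤⟨ +-monoˡ-≤ (suc r * b * w) (+-monoʳ-≤ (r * a * (k * u)) (*-monoʳ-≤ a duality)) ⟩
      r * a * (k * u) + a * (r * w) + suc r * b * w              ≡⟨ regroup r a b w k u ⟩
      r * a * (k * u) + (r * a + suc r * b) * w                  ∎
      where
      open ≤-Reasoning
      split : ∀ r a k t d → suc r * (r * a) * (k * (t + d)) ≡ suc r * (a * k * (r * t) + r * a * (k * d))
      split = solve-∀
      collect : ∀ r a b w k t u′ → suc r * (a * k * (r * t) + (a * (k * u′) + b * w)) ≡ suc r * (a * k * (r * t + u′) + b * w)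
      collect = solve-∀
      peel : ∀ r a b w k u → suc r * (a * k * u + b * w) ≡ r * a * (k * u) + a * (k * u) + suc r * b * w
      peel = solve-∀
      regroup : ∀ r a b w k u → r * a * (k * u) + a * (r * w) + suc r * b * w ≡ r * a * (k * u) + (r * a + suc r * b) * w
      regroup = solve-∀

  module _ (k : ℕ) (w : V → ℕ) (k≤Nw : ∀ v → k ≤ N v w) where

    -- Divided by (3+j)!, this is k|D| ≤ k|U|/(3+j) + (H(3+j) - 7/6) w(V). For `j = 0` the constant
    -- is 2/3, from 3|D| ≤ |U| + y(V) and k y(V) ≤ 2 w(V); each greedy stage adds one more harmonic
    -- term.
    chain : ∀ j U → (∀ u → N u (χ U) ≤ 2 + j) →
      ∃ λ D → Covered U D × (3 + j) ! * (k * length D) ≤ (2 + j) ! * (k * sum (χ U)) + excess j * sum w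
    chain zero U N≤2 with TwoBounded.cover-and-packing U N≤2
    ... | D , y , covered , _ , Ny≤2 , 3D≤ = D , covered , (begin
      6 * (k * length D)                             ≡⟨ triple k (length D) ⟩
      2 * k * (3 * length D)                         ≤⟨ *-monoʳ-≤ (2 * k) 3D≤ ⟩
      2 * k * (sum (χ U) + sum y)                    ≡⟨ distribute k (sum (χ U)) (sum y) ⟩
      2 * (k * sum (χ U)) + 2 * (k * sum y)          ≤⟨ +-monoʳ-≤ (2 * (k * sum (χ U))) (*-monoʳ-≤ 2 (weak-duality k w k≤Nw y 2 Ny≤2)) ⟩
      2 * (k * sum (χ U)) + 2 * (2 * sum w)          ≡⟨ cong (2 * (k * sum (χ U)) +_) (sym (*-assoc 2 2 (sum w))) ⟩
      2 * (k * sum (χ U)) + 4 * sum w                ∎)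
      where
      open ≤-Reasoning
      triple : ∀ k d → 6 * (k * d) ≡ 2 * k * (3 * d)
      triple = solve-∀
      distribute : ∀ k u y → 2 * k * (u + y) ≡ 2 * (k * u) + 2 * (k * y)
      distribute = solve-∀
    chain (suc j) U N≤ with greedy (2 + j) U
    ... | D , U′ , _ , N′≤ , size , upTo with chain j U′ N′≤
    ...   | D′ , covered , ih = D ++ D′ , covered-++ upTo covered ,
      subst (λ l → (4 + j) ! * (k * l) ≤ (3 + j) ! * (k * sum (χ U)) + excess (suc j) * sum w) (sym (length-++ D))
        (chain-step (3 + j) ((2 + j) !) (excess j) (sum w) k (length D) (length D′) (sum (χ U)) (sum (χ U′))
          ih size (weak-duality k w k≤Nw (χ U) (3 + j) N≤))

-- centreᵢ and leafᵢ mark the stars chosen when they dominate i new vertices; rest marks the vertices not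
-- yet dominated.
data Label : Set where
  centre₅ leaf₅ centre₄ leaf₄ rest : Label

isRest : Label → Bool
isRest rest = true
isRest _    = false

-- Every star is worth 180, and the values are balanced so that together with 60 + 60 y₂ on the remaining
-- vertices, where y₂ is the packing of TwoBounded, no closed neighbourhood exceeds 375 = 180 H(4).
value : Label → ℕ
value centre₅ = 40
value leaf₅   = 35
value centre₄ = 60
value leaf₄   = 40
value rest    = 0

rest⇒≡ : ∀ {l} → isRest l ≡ true → l ≡ rest
rest⇒≡ {rest} _ = refl

_≟ₗ_ : (l l′ : Label) → Dec (l ≡ l′)
l ≟ₗ l′ = map′ code-injective (cong code) (code l ℕ.≟ code l′)
  where
  code : Label → ℕ
  code centre₅ = 0
  code leaf₅   = 1
  code centre₄ = 2
  code leaf₄   = 3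
  code rest    = 4
  code-injective : ∀ {l l′} → code l ≡ code l′ → l ≡ l′
  code-injective {centre₅} {centre₅} _ = refl
  code-injective {leaf₅}   {leaf₅}   _ = refl
  code-injective {centre₄} {centre₄} _ = refl
  code-injective {leaf₄}   {leaf₄}   _ = refl
  code-injective {rest}    {rest}    _ = refl

-- Labelled greedy stars for maximum degree 4.

module Labelling (F : Graph) where
  open Neighbourhoods F
  open MinimumCovers F
  open Greedy F

  private
    V = Vertex F

  Rest : (V → Label) → V → Bool
  Rest ℓ v = isRest (ℓ v)

  Closed : (V → Label) → V → Set
  Closed ℓ d = ∀ w → d ⊲ w → Rest ℓ w ≡ false

  -- The dominator is a picked vertex, remembered only through the fact that its whole closed
  -- neighbourhood is dominated.
  Dominated : (V → Label) → Set
  Dominated ℓ = ∀ v → Rest ℓ v ≡ false → ∃ λ d → v ⊲ d × Closed ℓ d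

  -- Otherwise N[u] contains two dominated vertices, u and its dominator.
  four⇒rest : (∀ u → N u (λ _ → 1) ≤ 5) → ∀ {ℓ} → Dominated ℓ → ∀ {u} → 4 ≤ N u (χ (Rest ℓ)) → Rest ℓ u ≡ true
  four⇒rest ∣N∣≤5 {ℓ} dominated {u} 4≤N with Rest ℓ u in eq
  ... | true  = refl
  ... | false with dominated u eq
  ...   | d , u⊲d , closed with u ≟ d
  ...     | yes refl = contradiction (≤-trans 4≤N (≤-trans (N-mono u {z = λ _ → 0} none) (≤-reflexive (N-const u 0)))) λ ()
    where
    none : ∀ {v} → u ⊲ v → χ (Rest ℓ) v ≤ 0
    none u⊲v rewrite closed _ u⊲v = z≤n
  ...     | no u≢d = contradiction (≤-trans (+-monoˡ-≤ 2 4≤N) (≤-trans two-missing (∣N∣≤5 u))) (n≮n 5)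
    where
    δ : V → V → ℕ
    δ a v = 1 * 𝟙 (v ≟ a)
    pointwise : ∀ {v} → χ (Rest ℓ) v + (δ u v + δ d v) ≤ 1
    pointwise {v} with v ≟ u | v ≟ d
    ... | yes refl | yes refl = contradiction refl u≢d
    ... | yes refl | no _     rewrite eq = ≤-refl
    ... | no _     | yes refl rewrite closed d ⊲-refl = ≤-refl
    ... | no _     | no _ with Rest ℓ v
    ...   | true  = ≤-refl
    ...   | false = z≤n
    two-missing : N u (χ (Rest ℓ)) + 2 ≤ N u (λ _ → 1)
    two-missing = begin
      N u (χ (Rest ℓ)) + 2                           ≡⟨ cong (N u (χ (Rest ℓ)) +_) (cong₂ _+_ (N-δ {u} ⊲-refl 1) (N-δ u⊲d 1)) ⟨
      N u (χ (Rest ℓ)) + (N u (δ u) + N u (δ d))     ≡⟨ cong (N u (χ (Rest ℓ)) +_) (N-+ u (δ u) (δ d)) ⟨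
      N u (χ (Rest ℓ)) + N u (λ v → δ u v + δ d v)   ≡⟨ N-+ u (χ (Rest ℓ)) (λ v → δ u v + δ d v) ⟨
      N u (λ v → χ (Rest ℓ) v + (δ u v + δ d v))     ≤⟨ N-mono u (λ {v} _ → pointwise {v}) ⟩
      N u (λ _ → 1)                                  ∎
      where open ≤-Reasoning

  -- `e` is the surplus of a centre over a leaf. Since `3≤i`, every pick has at least four
  -- undominated vertices near it, so by `four⇒rest` the pick is itself undominated and can receive
  -- the surplus.
  module Stage (∣N∣≤5 : ∀ u → N u (λ _ → 1) ≤ 5) (centreₛ leafₛ : Label)
    (centreₛ≢rest : isRest centreₛ ≡ false) (leafₛ≢rest : isRest leafₛ ≡ false)
    (i : ℕ) (3≤i : 3 ≤ i) (e : ℕ) (centre-value : value leafₛ + e ≤ value centreₛ)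
    (star-value : 180 ≤ value leafₛ * suc i + e) where

    NewLabel : (V → Label) → V → Set
    NewLabel ℓ v = ℓ v ≡ rest ⊎ (ℓ v ≡ leafₛ × ∃ λ p → v ⊲ p × ℓ p ≡ centreₛ) ⊎ (ℓ v ≡ centreₛ × Closed ℓ v)

    record Result (ℓ : V → Label) : Set where
      field
        picks     : List V
        ℓ′        : V → Label
        keep      : ∀ {v} → Rest ℓ v ≡ false → ℓ′ v ≡ ℓ v
        new       : ∀ {v} → Rest ℓ v ≡ true → NewLabel ℓ′ v
        dominated : Dominated ℓ′
        bounded   : ∀ u → N u (χ (Rest ℓ′)) ≤ i
        values    : 180 * length picks + sum (value ∘ ℓ) ≤ sum (value ∘ ℓ′)
        covered   : CoveredUpTo (Rest ℓ) (Rest ℓ′) picks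

    module Pick (ℓ : V → Label) (dominated : Dominated ℓ) (p : V) (big : suc i ≤ N p (χ (Rest ℓ))) where

      p-rest : Rest ℓ p ≡ true
      p-rest = four⇒rest ∣N∣≤5 {ℓ} dominated (≤-trans (s≤s 3≤i) big)

      label : Bool → Bool → Bool → Label → Label
      label true true true  l = centreₛ
      label true true false l = leafₛ
      label _    _    _     l = l

      ℓ₁ : V → Label
      ℓ₁ v = label (Rest ℓ v) (does (p ⊲? v)) (does (v ≟ p)) (ℓ v)

      keep₁ : ∀ {v} → Rest ℓ v ≡ false → ℓ₁ v ≡ ℓ v
      keep₁ {v} eq = cong (λ b → label b (does (p ⊲? v)) (does (v ≟ p)) (ℓ v)) eq

      ℓ₁-p : ℓ₁ p ≡ centreₛ
      ℓ₁-p = trans (cong (λ b → label b (does (p ⊲? p)) (does (p ≟ p)) (ℓ p)) p-rest)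
        (cong₂ (λ b b′ → label true b b′ (ℓ p)) (dec-true (p ⊲? p) ⊲-refl) (dec-true (p ≟ p) refl))

      ℓ₁-leaf : ∀ {v} → Rest ℓ v ≡ true → p ⊲ v → v ≢ p → ℓ₁ v ≡ leafₛ
      ℓ₁-leaf {v} eq p⊲v v≢p = trans (cong (λ b → label b (does (p ⊲? v)) (does (v ≟ p)) (ℓ v)) eq)
        (cong₂ (λ b b′ → label true b b′ (ℓ v)) (dec-true (p ⊲? v) p⊲v) (dec-false (v ≟ p) v≢p))

      ℓ₁-far : ∀ {v} → ¬ p ⊲ v → ℓ₁ v ≡ ℓ v
      ℓ₁-far {v} ¬p⊲v = trans (cong (λ b → label (Rest ℓ v) b (does (v ≟ p)) (ℓ v)) (dec-false (p ⊲? v) ¬p⊲v)) (far (Rest ℓ v))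
        where
        far : ∀ b → label b false (does (v ≟ p)) (ℓ v) ≡ ℓ v
        far true  = refl
        far false = refl

      closed-p : ∀ {v} → p ⊲ v → Rest ℓ₁ v ≡ false
      closed-p {v} p⊲v = case Rest ℓ v Bool.≟ true of λ where
        (no ¬rest) → trans (cong isRest (keep₁ (Bool.¬-not ¬rest))) (Bool.¬-not ¬rest)
        (yes r)    → case v ≟ p of λ where
          (yes refl) → trans (cong isRest ℓ₁-p) centreₛ≢rest
          (no v≢p)   → trans (cong isRest (ℓ₁-leaf r p⊲v v≢p)) leafₛ≢rest

      shrink : ∀ {v} → Rest ℓ v ≡ false → Rest ℓ₁ v ≡ false
      shrink eq = trans (cong isRest (keep₁ eq)) eq

      dominated₁ : Dominated ℓ₁
      dominated₁ v ¬rest = case p ⊲? v of λ where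
        (yes p⊲v) → p , ⊲-sym p⊲v , λ _ → closed-p
        (no ¬p⊲v) → let d , v⊲d , closed = dominated v (trans (cong isRest (sym (ℓ₁-far ¬p⊲v))) ¬rest) in
          d , v⊲d , λ w d⊲w → shrink (closed w d⊲w)

      drop : suc i + sum (χ (Rest ℓ₁)) ≤ sum (χ (Rest ℓ))
      drop = ≤-trans (≤-reflexive (+-comm (suc i) (sum (χ (Rest ℓ₁)))))
        (≤-trans (+-monoʳ-≤ (sum (χ (Rest ℓ₁))) big) (sum-split (χ (Rest ℓ₁)) _ (χ (Rest ℓ)) pointwise))
        where
        pointwise : ∀ v → χ (Rest ℓ₁) v + 𝟙 (p ⊲? v) * χ (Rest ℓ) v ≤ χ (Rest ℓ) v
        pointwise v = go (p ⊲? v)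
          where
          go : (d : Dec (p ⊲ v)) → χ (Rest ℓ₁) v + 𝟙 d * χ (Rest ℓ) v ≤ χ (Rest ℓ) v
          go (yes p⊲v) rewrite closed-p p⊲v = ≤-reflexive (+-identityʳ _)
          go (no ¬p⊲v) = ≤-reflexive (trans (+-identityʳ _) (cong (λ l → if isRest l then 1 else 0) (ℓ₁-far ¬p⊲v)))

      values₁ : 180 + sum (value ∘ ℓ) ≤ sum (value ∘ ℓ₁)
      values₁ = begin
        180 + sum (value ∘ ℓ)                                                      ≤⟨ +-monoˡ-≤ (sum (value ∘ ℓ)) star-value ⟩
        value leafₛ * suc i + e + sum (value ∘ ℓ)                                  ≤⟨ +-monoˡ-≤ (sum (value ∘ ℓ)) (+-monoˡ-≤ e (*-monoʳ-≤ (value leafₛ) big)) ⟩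
        value leafₛ * N p (χ (Rest ℓ)) + e + sum (value ∘ ℓ)                       ≡⟨ cong (_+ sum (value ∘ ℓ)) (cong₂ _+_ (*-distribˡ-sum (value leafₛ) (λ v → 𝟙 (p ⊲? v) * χ (Rest ℓ) v)) (sym (sum-δ p (λ _ → e)))) ⟩
        sum leaves + sum centres + sum (value ∘ ℓ)                                 ≡⟨ cong (_+ sum (value ∘ ℓ)) (∑-distrib-+ leaves centres) ⟨
        sum (λ v → leaves v + centres v) + sum (value ∘ ℓ)                         ≤⟨ sum-split (λ v → leaves v + centres v) (value ∘ ℓ) (value ∘ ℓ₁) pointwise ⟩
        sum (value ∘ ℓ₁)                                                           ∎
        where
        open ≤-Reasoning
        leaves centres : V → ℕ
        leaves v = value leafₛ * (𝟙 (p ⊲? v) * χ (Rest ℓ) v)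
        centres v = 𝟙 (v ≟ p) * e
        pointwise : ∀ v → leaves v + centres v + value (ℓ v) ≤ value (ℓ₁ v)
        pointwise v = cases
          where
          eval : ∀ {x z t} → 𝟙 (p ⊲? v) ≡ x → χ (Rest ℓ) v ≡ z → 𝟙 (v ≟ p) ≡ t →
            value leafₛ * (x * z) + t * e + value (ℓ v) ≤ value (ℓ₁ v) → leaves v + centres v + value (ℓ v) ≤ value (ℓ₁ v)
          eval refl refl refl h = h
          χ≡ : ∀ {b} → Rest ℓ v ≡ b → χ (Rest ℓ) v ≡ (if b then 1 else 0)
          χ≡ = cong (λ b → if b then 1 else 0)
          drop-zeros : Rest ℓ v ≡ true → value leafₛ * 1 + 0 + value (ℓ v) ≡ value leafₛ
          drop-zeros r rewrite rest⇒≡ {ℓ v} r = trans (+-identityʳ _) (trans (+-identityʳ _) (*-identityʳ (value leafₛ)))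
          add-centre : Rest ℓ v ≡ true → value leafₛ * 1 + 1 * e + value (ℓ v) ≡ value leafₛ + e
          add-centre r rewrite rest⇒≡ {ℓ v} r = trans (+-identityʳ _) (cong₂ _+_ (*-identityʳ (value leafₛ)) (+-identityʳ e))
          cases : leaves v + centres v + value (ℓ v) ≤ value (ℓ₁ v)
          cases = case Rest ℓ v Bool.≟ true of λ where
            (no ¬r) → eval refl (χ≡ (Bool.¬-not ¬r)) (𝟙-no (v ≟ p) (λ { refl → ¬r p-rest }))
              (≤-reflexive (trans (cong (λ x → x + 0 + value (ℓ v)) (trans (cong (value leafₛ *_) (*-zeroʳ (𝟙 (p ⊲? v)))) (*-zeroʳ (value leafₛ))))
                (cong value (sym (keep₁ (Bool.¬-not ¬r))))))
            (yes r) → case p ⊲? v of λ where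
              (no ¬p⊲v) → eval (𝟙-no (p ⊲? v) ¬p⊲v) refl (𝟙-no (v ≟ p) (λ { refl → ¬p⊲v ⊲-refl }))
                (≤-reflexive (trans (cong (λ x → x + 0 + value (ℓ v)) (*-zeroʳ (value leafₛ))) (cong value (sym (ℓ₁-far ¬p⊲v)))))
              (yes p⊲v) → case v ≟ p of λ where
                (no v≢p) → eval (𝟙-yes (p ⊲? v) p⊲v) (χ≡ r) (𝟙-no (v ≟ p) v≢p)
                  (≤-reflexive (trans (drop-zeros r) (cong value (sym (ℓ₁-leaf r p⊲v v≢p)))))
                (yes refl) → eval (𝟙-yes (p ⊲? p) p⊲v) (χ≡ r) (𝟙-yes (p ≟ p) refl)
                  (≤-trans (≤-reflexive (add-centre r)) (≤-trans centre-value (≤-reflexive (cong value (sym ℓ₁-p)))))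

    run : ∀ ℓ → Dominated ℓ → Result ℓ
    run ℓ dominated = go (sum (χ (Rest ℓ))) ℓ dominated ≤-refl
      where
      go : ∀ fuel ℓ → Dominated ℓ → sum (χ (Rest ℓ)) ≤ fuel → Result ℓ
      go fuel ℓ dominated bound with any? (λ u → suc i ≤? N u (χ (Rest ℓ)))
      ... | no ¬big = record
        { picks     = []
        ; ℓ′        = ℓ
        ; keep      = λ _ → refl
        ; new       = λ r → inj₁ (rest⇒≡ r)
        ; dominated = dominated
        ; bounded   = λ u → ≤-pred (≰⇒> (λ i<N → ¬big (u , i<N)))
        ; values    = ≤-refl
        ; covered   = λ _ r → inj₁ r
        }
      ... | yes (p , big) = pick fuel bound
        where
        open Pick ℓ dominated p big
        pick : ∀ fuel → sum (χ (Rest ℓ)) ≤ fuel → Result ℓ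
        pick zero       bound = contradiction (≤-trans drop bound) λ ()
        pick (suc fuel) bound = record
          { picks     = p ∷ picks
          ; ℓ′        = ℓ′
          ; keep      = λ eq → trans (keep (shrink eq)) (keep₁ eq)
          ; new       = λ r → new′ r
          ; dominated = dominated′
          ; bounded   = bounded
          ; values    = values′
          ; covered   = covered′
          }
          where
          open Result (go fuel ℓ₁ dominated₁
            (≤-pred (≤-trans (+-monoˡ-≤ (sum (χ (Rest ℓ₁))) (s≤s (z≤n {i}))) (≤-trans drop bound))))
            renaming (dominated to dominated′)
          ℓ′-p : ℓ′ p ≡ centreₛ
          ℓ′-p = trans (keep (closed-p ⊲-refl)) ℓ₁-p
          new′ : ∀ {v} → Rest ℓ v ≡ true → NewLabel ℓ′ v
          new′ {v} r = case p ⊲? v of λ where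
            (no ¬p⊲v) → new (trans (cong isRest (ℓ₁-far ¬p⊲v)) r)
            (yes p⊲v) → case v ≟ p of λ where
              (yes refl) → inj₂ (inj₂ (ℓ′-p , λ _ p⊲w → trans (cong isRest (keep (closed-p p⊲w))) (closed-p p⊲w)))
              (no v≢p)   → inj₂ (inj₁ (trans (keep (closed-p p⊲v)) (ℓ₁-leaf r p⊲v v≢p) , p , ⊲-sym p⊲v , ℓ′-p))
          values′ : 180 * suc (length picks) + sum (value ∘ ℓ) ≤ sum (value ∘ ℓ′)
          values′ = begin
            180 * suc (length picks) + sum (value ∘ ℓ)        ≡⟨ peel (length picks) (sum (value ∘ ℓ)) ⟩
            180 * length picks + (180 + sum (value ∘ ℓ))      ≤⟨ +-monoʳ-≤ (180 * length picks) values₁ ⟩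
            180 * length picks + sum (value ∘ ℓ₁)             ≤⟨ values ⟩
            sum (value ∘ ℓ′)                                  ∎
            where
            open ≤-Reasoning
            peel : ∀ t s → 180 * suc t + s ≡ 180 * t + (180 + s)
            peel = solve-∀
          covered′ : CoveredUpTo (Rest ℓ) (Rest ℓ′) (p ∷ picks)
          covered′ v r = case p ⊲? v of λ where
            (yes p⊲v) → inj₂ (p , here refl , ⊲-sym p⊲v)
            (no ¬p⊲v) → case covered v (trans (cong isRest (ℓ₁-far ¬p⊲v)) r) of λ where
              (inj₁ r′)             → inj₁ r′
              (inj₂ (d , d∈ , v⊲d)) → inj₂ (d , there d∈ , v⊲d)

  -- The packing for maximum degree 4.

  module MaxDegree4 (∣N∣≤5 : ∀ u → N u (λ _ → 1) ≤ 5) where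
    -- The surpluses complete the stars to 180: 5 * 35 + 5 and 4 * 40 + 20.
    module Stage₅ = Stage ∣N∣≤5 centre₅ leaf₅ refl refl 4 (s≤s (s≤s (s≤s z≤n))) 5 ≤-refl ≤-refl
    module Stage₄ = Stage ∣N∣≤5 centre₄ leaf₄ refl refl 3 ≤-refl 20 ≤-refl ≤-refl

    module Assemble (R₅ : Stage₅.Result (λ _ → rest)) (R₄ : Stage₄.Result (Stage₅.Result.ℓ′ R₅)) where
      open Stage₅.Result R₅ using () renaming (picks to D₅; ℓ′ to ℓ₅; new to new₅; bounded to bounded₅; values to values₅; covered to covered₅)
      open Stage₄.Result R₄ using () renaming (picks to D₄; ℓ′ to ℓ; keep to keep₄; new to new₄; bounded to bounded₄; values to values₄; covered to covered₄)

      data View (v : V) : Set where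
        is-centre₅ : ℓ v ≡ centre₅ → Rest ℓ₅ v ≡ false → (∀ w → v ⊲ w → Rest ℓ₅ w ≡ false) → View v
        is-leaf₅   : ℓ v ≡ leaf₅ → Rest ℓ₅ v ≡ false → (∃ λ p → v ⊲ p × ℓ p ≡ centre₅) → View v
        is-centre₄ : ℓ v ≡ centre₄ → Rest ℓ₅ v ≡ true → Closed ℓ v → View v
        is-leaf₄   : ℓ v ≡ leaf₄ → Rest ℓ₅ v ≡ true → View v
        is-rest    : ℓ v ≡ rest → Rest ℓ₅ v ≡ true → View v

      view : ∀ v → View v
      view v = case Rest ℓ₅ v Bool.≟ true of λ where
        (yes r) → case new₄ r of λ where
          (inj₁ eq)                   → is-rest eq r
          (inj₂ (inj₁ (eq , _)))      → is-leaf₄ eq r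
          (inj₂ (inj₂ (eq , closed))) → is-centre₄ eq r closed
        (no ¬r) → let kept = keep₄ (Bool.¬-not ¬r) in case new₅ {v} refl of λ where
          (inj₁ eq)                              → contradiction (cong isRest eq) ¬r
          (inj₂ (inj₁ (eq , p , v⊲p , p-centre))) →
            is-leaf₅ (trans kept eq) (Bool.¬-not ¬r) (p , v⊲p , trans (keep₄ (cong isRest p-centre)) p-centre)
          (inj₂ (inj₂ (eq , closed)))            → is-centre₅ (trans kept eq) (Bool.¬-not ¬r) closed

      -- The price apart from `60 * y₂`. A remaining vertex costs 60 because a star of three must be
      -- worth 180.
      base : V → ℕ
      base v = value (ℓ v) + 60 * χ (Rest ℓ) v

      base-at : ∀ {v l} → ℓ v ≡ l → base v ≡ value l + 60 * χ isRest l
      base-at = cong (λ l → value l + 60 * χ isRest l)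

      χ-at : ∀ {U : V → Bool} {v b} → U v ≡ b → χ U v ≡ (if b then 1 else 0)
      χ-at = cong (λ b → if b then 1 else 0)

      base≤60 : ∀ v → base v ≤ 60
      base≤60 v = case view v of λ where
        (is-centre₅ eq _ _) → ≤-trans (≤-reflexive (base-at eq)) (m≤m+n 40 20)
        (is-leaf₅ eq _ _)   → ≤-trans (≤-reflexive (base-at eq)) (m≤m+n 35 25)
        (is-centre₄ eq _ _) → ≤-reflexive (base-at eq)
        (is-leaf₄ eq _)     → ≤-trans (≤-reflexive (base-at eq)) (m≤m+n 40 20)
        (is-rest eq _)      → ≤-reflexive (base-at eq)

      -- When the stage of five-stars ends, the whole closed neighbourhood of `p` is dominated, so
      -- `u` got its label in that stage.
      near-centre₅ : ∀ {u p} → u ⊲ p → ℓ p ≡ centre₅ → ℓ u ≡ centre₅ ⊎ ℓ u ≡ leaf₅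
      near-centre₅ {u} {p} u⊲p eq = case view u of λ where
          (is-centre₅ equ _ _) → inj₁ equ
          (is-leaf₅ equ _ _)   → inj₂ equ
          (is-centre₄ _ r _)   → contradiction (trans (sym r) ¬rest) λ ()
          (is-leaf₄ _ r)       → contradiction (trans (sym r) ¬rest) λ ()
          (is-rest _ r)        → contradiction (trans (sym r) ¬rest) λ ()
        where
        closed₅ : ∀ {w} → p ⊲ w → Rest ℓ₅ w ≡ false
        closed₅ = case view p of λ where
          (is-centre₅ _ _ closed) → closed _
          (is-leaf₅ eq′ _ _)      → contradiction (trans (sym eq) eq′) λ ()
          (is-centre₄ eq′ _ _)    → contradiction (trans (sym eq) eq′) λ ()
          (is-leaf₄ eq′ _)        → contradiction (trans (sym eq) eq′) λ ()
          (is-rest eq′ _)         → contradiction (trans (sym eq) eq′) λ ()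
        ¬rest : Rest ℓ₅ u ≡ false
        ¬rest = closed₅ (⊲-sym u⊲p)

      -- With no remaining vertex near `u` the packing `y₂` vanishes there, and the crude price 60
      -- suffices: 5 * 60 = 300.
      N-no-rest : ∀ {u} → Closed ℓ u → ∀ {y₂ : V → ℕ} → (∀ v → Rest ℓ v ≡ false → y₂ v ≡ 0) → N u (λ v → base v + 60 * y₂ v) ≤ 375
      N-no-rest {u} closed {y₂} support = begin
        N u (λ v → base v + 60 * y₂ v)    ≤⟨ N-mono u (λ {v} u⊲v → +-mono-≤ (base≤60 v) (≤-reflexive (cong (60 *_) (support v (closed v u⊲v))))) ⟩
        N u (λ _ → 60)                    ≡⟨ N-const u 60 ⟩
        60 * N u (λ _ → 1)                ≤⟨ *-monoʳ-≤ 60 (∣N∣≤5 u) ⟩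
        300                               ≤⟨ m≤m+n 300 75 ⟩
        375                               ∎
        where open ≤-Reasoning

      -- The centre counts 40, `u` itself 35, and the three others at most 60 each: 255.
      N-leaf₅ : ∀ {u p} → u ⊲ p → ℓ p ≡ centre₅ → ℓ u ≡ leaf₅ → N u base ≤ 255
      N-leaf₅ {u} {p} u⊲p p-centre u-leaf = +-cancelʳ-≤ 45 (N u base) 255 (begin
        N u base + 45                                  ≡⟨ cong (N u base +_) (cong₂ _+_ (N-δ u⊲p 20) (N-δ {u} ⊲-refl 25)) ⟨
        N u base + (N u (δ 20 p) + N u (δ 25 u))       ≡⟨ cong (N u base +_) (N-+ u (δ 20 p) (δ 25 u)) ⟨
        N u base + N u (λ v → δ 20 p v + δ 25 u v)     ≡⟨ N-+ u base (λ v → δ 20 p v + δ 25 u v) ⟨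
        N u (λ v → base v + (δ 20 p v + δ 25 u v))     ≤⟨ N-mono u (λ {v} _ → pointwise v) ⟩
        N u (λ _ → 60)                                 ≡⟨ N-const u 60 ⟩
        60 * N u (λ _ → 1)                             ≤⟨ *-monoʳ-≤ 60 (∣N∣≤5 u) ⟩
        300                                            ∎)
        where
        open ≤-Reasoning
        δ : ℕ → V → V → ℕ
        δ k a v = k * 𝟙 (v ≟ a)
        pointwise : ∀ v → base v + (δ 20 p v + δ 25 u v) ≤ 60
        pointwise v with v ≟ p | v ≟ u
        ... | yes refl | yes refl = contradiction (trans (sym p-centre) u-leaf) λ ()
        ... | yes refl | no _     = ≤-reflexive (cong (_+ 20) (base-at p-centre))
        ... | no _     | yes refl = ≤-reflexive (cong (_+ 25) (base-at u-leaf))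
        ... | no _     | no _     = ≤-trans (≤-reflexive (+-identityʳ (base v))) (base≤60 v)

      -- At most four vertices near `u` survive the first stage; a fifth one is a `leaf₅` worth 35.
      -- As `u` counts 40 instead of 60, the load is at most 35 + 40 + 3 * 60 = 255.
      N-leaf₄ : ∀ {u} → (∀ {v} → u ⊲ v → ℓ v ≢ centre₅) → ℓ u ≡ leaf₄ → Rest ℓ₅ u ≡ true → N u base ≤ 255
      N-leaf₄ {u} no-centre₅ u-leaf u-rest = +-cancelʳ-≤ 20 (N u base) 255 (begin
        N u base + 20                                         ≡⟨ cong (N u base +_) (N-δ {u} ⊲-refl 20) ⟨
        N u base + N u (λ v → 20 * 𝟙 (v ≟ u))                 ≡⟨ N-+ u base (λ v → 20 * 𝟙 (v ≟ u)) ⟨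
        N u (λ v → base v + 20 * 𝟙 (v ≟ u))                   ≤⟨ N-mono u (λ {v} u⊲v → pointwise v u⊲v) ⟩
        N u (λ v → 35 + 25 * χ (Rest ℓ₅) v)                   ≡⟨ N-+ u (λ _ → 35) (λ v → 25 * χ (Rest ℓ₅) v) ⟩
        N u (λ _ → 35) + N u (λ v → 25 * χ (Rest ℓ₅) v)       ≡⟨ cong₂ _+_ (N-const u 35) (N-* u 25 (χ (Rest ℓ₅))) ⟩
        35 * N u (λ _ → 1) + 25 * N u (χ (Rest ℓ₅))           ≤⟨ +-mono-≤ (*-monoʳ-≤ 35 (∣N∣≤5 u)) (*-monoʳ-≤ 25 (bounded₅ u)) ⟩
        275                                                   ∎)
        where
        open ≤-Reasoning
        at-rest : ∀ {v} → Rest ℓ₅ v ≡ true → 60 ≤ 35 + 25 * χ (Rest ℓ₅) v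
        at-rest {v} r = ≤-reflexive (cong (λ x → 35 + 25 * x) (sym (χ-at {Rest ℓ₅} {v} r)))
        base≤ : ∀ v → u ⊲ v → base v ≤ 35 + 25 * χ (Rest ℓ₅) v
        base≤ v u⊲v = case view v of λ where
          (is-centre₅ eq _ _) → contradiction eq (no-centre₅ u⊲v)
          (is-leaf₅ eq _ _)   → ≤-trans (≤-reflexive (base-at eq)) (m≤m+n 35 (25 * χ (Rest ℓ₅) v))
          (is-centre₄ _ r _)  → ≤-trans (base≤60 v) (at-rest r)
          (is-leaf₄ _ r)      → ≤-trans (base≤60 v) (at-rest r)
          (is-rest _ r)       → ≤-trans (base≤60 v) (at-rest r)
        pointwise : ∀ v → u ⊲ v → base v + 20 * 𝟙 (v ≟ u) ≤ 35 + 25 * χ (Rest ℓ₅) v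
        pointwise v u⊲v with v ≟ u
        ... | yes refl = ≤-trans (≤-reflexive (cong (_+ 20) (base-at u-leaf))) (at-rest u-rest)
        ... | no _     = ≤-trans (≤-reflexive (+-identityʳ (base v))) (base≤ v u⊲v)

      -- Every vertex counts at least towards 35; at most four survive the first stage and rise by 5
      -- to 40, and at most three survive the second and rise by 20 to 60: 175 + 20 + 60 = 255.
      N-no-centre : ∀ {u} → (∀ {v} → u ⊲ v → ℓ v ≢ centre₅) → (∀ {v} → u ⊲ v → ℓ v ≢ centre₄) → N u base ≤ 255
      N-no-centre {u} no-centre₅ no-centre₄ = begin
        N u base                                                      ≤⟨ N-mono u (λ {v} u⊲v → pointwise v u⊲v) ⟩
        N u (λ v → 35 + (5 * χ (Rest ℓ₅) v + 20 * χ (Rest ℓ) v))      ≡⟨ N-+ u (λ _ → 35) (λ v → 5 * χ (Rest ℓ₅) v + 20 * χ (Rest ℓ) v) ⟩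
        N u (λ _ → 35) + N u (λ v → 5 * χ (Rest ℓ₅) v + 20 * χ (Rest ℓ) v)
          ≡⟨ cong₂ _+_ (N-const u 35) (trans (N-+ u (λ v → 5 * χ (Rest ℓ₅) v) (λ v → 20 * χ (Rest ℓ) v)) (cong₂ _+_ (N-* u 5 (χ (Rest ℓ₅))) (N-* u 20 (χ (Rest ℓ))))) ⟩
        35 * N u (λ _ → 1) + (5 * N u (χ (Rest ℓ₅)) + 20 * N u (χ (Rest ℓ)))
          ≤⟨ +-mono-≤ (*-monoʳ-≤ 35 (∣N∣≤5 u)) (+-mono-≤ (*-monoʳ-≤ 5 (bounded₅ u)) (*-monoʳ-≤ 20 (bounded₄ u))) ⟩
        255                                                           ∎
        where
        open ≤-Reasoning
        pointwise : ∀ v → u ⊲ v → base v ≤ 35 + (5 * χ (Rest ℓ₅) v + 20 * χ (Rest ℓ) v)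
        pointwise v u⊲v = case view v of λ where
          (is-centre₅ eq _ _) → contradiction eq (no-centre₅ u⊲v)
          (is-centre₄ eq _ _) → contradiction eq (no-centre₄ u⊲v)
          (is-leaf₅ eq _ _)   → ≤-trans (≤-reflexive (base-at eq)) (m≤m+n 35 (5 * χ (Rest ℓ₅) v + 20 * χ (Rest ℓ) v))
          (is-leaf₄ eq r)     → ≤-trans (≤-reflexive (base-at eq))
            (+-monoʳ-≤ 35 (≤-trans (≤-reflexive (cong (5 *_) (sym (χ-at {Rest ℓ₅} {v} r)))) (m≤m+n (5 * χ (Rest ℓ₅) v) _)))
          (is-rest eq r)      → ≤-reflexive (trans (base-at eq)
            (cong (35 +_) (cong₂ (λ a b → 5 * a + 20 * b) (sym (χ-at {Rest ℓ₅} {v} r)) (sym (χ-at {Rest ℓ} {v} (cong isRest eq))))))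

      module _ (y₂ : V → ℕ) (support : ∀ v → Rest ℓ v ≡ false → y₂ v ≡ 0) (Ny₂≤2 : ∀ u → N u y₂ ≤ 2) where

        y : V → ℕ
        y v = base v + 60 * y₂ v

        255⇒375 : ∀ u → N u base ≤ 255 → N u y ≤ 375
        255⇒375 u N≤ = ≤-trans (≤-reflexive (trans (N-+ u base (λ v → 60 * y₂ v)) (cong (N u base +_) (N-* u 60 y₂))))
          (+-mono-≤ N≤ (*-monoʳ-≤ 60 (Ny₂≤2 u)))

        Ny≤375 : ∀ u → N u y ≤ 375
        -- Either nothing near `u` remains undominated, or `base` has load at most 255 and `60 * y₂`
        -- adds at most 120.
        Ny≤375 u = case any? (λ p → (u ⊲? p) ×-dec label? centre₅ p) of λ where
            (yes (p , u⊲p , p-centre)) → case near-centre₅ u⊲p p-centre of λ where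
              (inj₂ u-leaf)   → 255⇒375 u (N-leaf₅ u⊲p p-centre u-leaf)
              (inj₁ u-centre) → N-no-rest (λ v u⊲v → not-rest (near-centre₅ (⊲-sym u⊲v) u-centre)) support
            (no ¬centre₅) → case any? (λ f → (u ⊲? f) ×-dec label? centre₄ f) of λ where
              (no ¬centre₄) → 255⇒375 u (N-no-centre (λ u⊲v eq → ¬centre₅ (_ , u⊲v , eq)) (λ u⊲v eq → ¬centre₄ (_ , u⊲v , eq)))
              (yes (f , u⊲f , f-centre)) → case view u of λ where
                (is-centre₅ eq _ _)          → contradiction (u , ⊲-refl , eq) ¬centre₅
                (is-leaf₅ _ _ centre)        → contradiction centre ¬centre₅
                (is-centre₄ _ _ closed)      → N-no-rest closed support
                (is-leaf₄ eq r)              → 255⇒375 u (N-leaf₄ (λ u⊲v eq → ¬centre₅ (_ , u⊲v , eq)) eq r)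
                (is-rest eq _)               → contradiction (trans (sym (cong isRest eq)) (closed₄ f f-centre (⊲-sym u⊲f))) λ ()
          where
          label? : ∀ l v → Dec (ℓ v ≡ l)
          label? l v = ℓ v ≟ₗ l
          not-rest : ∀ {v} → ℓ v ≡ centre₅ ⊎ ℓ v ≡ leaf₅ → Rest ℓ v ≡ false
          not-rest (inj₁ eq) = cong isRest eq
          not-rest (inj₂ eq) = cong isRest eq
          closed₄ : ∀ f → ℓ f ≡ centre₄ → ∀ {w} → f ⊲ w → Rest ℓ w ≡ false
          closed₄ f eq = case view f of λ where
            (is-centre₄ _ _ closed) → closed _
            (is-centre₅ eq′ _ _)    → contradiction (trans (sym eq) eq′) λ ()
            (is-leaf₅ eq′ _ _)      → contradiction (trans (sym eq) eq′) λ ()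
            (is-leaf₄ eq′ _)        → contradiction (trans (sym eq) eq′) λ ()
            (is-rest eq′ _)         → contradiction (trans (sym eq) eq′) λ ()

      -- Stars of three need no distinction between centre and leaves: at 60 per vertex they are
      -- paid in full. The rest is paid by 60 times the estimate 3|D₂| ≤ |U₂| + y₂(V).
      packing : Packing 180 375
      packing with greedy 2 (Rest ℓ)
      ... | D₃ , U₂ , U₂⊆ , N≤2 , size₃ , covered₃ with TwoBounded.cover-and-packing U₂ N≤2
      ...   | D₂ , y₂ , covered₂ , support , Ny₂≤2 , size₂ =
        y y₂ support′ Ny₂≤2 , total , Ny≤375 y₂ support′ Ny₂≤2
        where
        open ≤-Reasoning
        support′ : ∀ v → Rest ℓ v ≡ false → y₂ v ≡ 0
        support′ v ¬r = case U₂ v Bool.≟ true of λ where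
          (yes U₂v) → contradiction (trans (sym (U₂⊆ v U₂v)) ¬r) λ ()
          (no ¬U₂v) → support v (Bool.¬-not ¬U₂v)
        D : List V
        D = D₅ ++ (D₄ ++ (D₃ ++ D₂))
        γ≤ : γ F ≤ length D
        γ≤ = γ≤length D (λ v → covered-++ covered₅ (covered-++ covered₄ (covered-++ covered₃ covered₂)) v refl)
        ∣D∣ : length D ≡ length D₅ + (length D₄ + (length D₃ + length D₂))
        ∣D∣ = trans (length-++ D₅) (cong (length D₅ +_) (trans (length-++ D₄) (cong (length D₄ +_) (length-++ D₃))))
        collect : ∀ a b c d → 180 * (a + (b + (c + d))) ≡ 180 * b + 180 * a + 60 * (3 * c + 3 * d)
        collect = solve-∀
        merge : ∀ p r q → p + 60 * (r + q) ≡ p + 60 * r + 60 * q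
        merge = solve-∀
        small : 3 * length D₃ + 3 * length D₂ ≤ sum (χ (Rest ℓ)) + sum y₂
        small = begin
          3 * length D₃ + 3 * length D₂                      ≤⟨ +-monoʳ-≤ (3 * length D₃) size₂ ⟩
          3 * length D₃ + (sum (χ U₂) + sum y₂)              ≡⟨ +-assoc (3 * length D₃) (sum (χ U₂)) (sum y₂) ⟨
          3 * length D₃ + sum (χ U₂) + sum y₂                ≤⟨ +-monoˡ-≤ (sum y₂) size₃ ⟩
          sum (χ (Rest ℓ)) + sum y₂                          ∎
        stars : 180 * length D₄ + 180 * length D₅ ≤ sum (value ∘ ℓ)
        stars = ≤-trans (+-monoʳ-≤ (180 * length D₄) (≤-trans (m≤m+n (180 * length D₅) _) values₅)) values₄
        total : 180 * γ F ≤ sum (y y₂ support′ Ny₂≤2)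
        total = begin
          180 * γ F                                                                    ≤⟨ *-monoʳ-≤ 180 γ≤ ⟩
          180 * length D                                                               ≡⟨ trans (cong (180 *_) ∣D∣) (collect (length D₅) (length D₄) (length D₃) (length D₂)) ⟩
          180 * length D₄ + 180 * length D₅ + 60 * (3 * length D₃ + 3 * length D₂)     ≤⟨ +-mono-≤ stars (*-monoʳ-≤ 60 small) ⟩
          sum (value ∘ ℓ) + 60 * (sum (χ (Rest ℓ)) + sum y₂)                           ≡⟨ merge (sum (value ∘ ℓ)) (sum (χ (Rest ℓ))) (sum y₂) ⟩
          sum (value ∘ ℓ) + 60 * sum (χ (Rest ℓ)) + 60 * sum y₂                        ≡⟨ cong₂ (λ a b → sum (value ∘ ℓ) + a + b) (*-distribˡ-sum 60 (χ (Rest ℓ))) (*-distribˡ-sum 60 y₂) ⟩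
          sum (value ∘ ℓ) + sum (λ v → 60 * χ (Rest ℓ) v) + sum (λ v → 60 * y₂ v)      ≡⟨ cong (_+ sum (λ v → 60 * y₂ v)) (∑-distrib-+ (value ∘ ℓ) (λ v → 60 * χ (Rest ℓ) v)) ⟨
          sum base + sum (λ v → 60 * y₂ v)                                             ≡⟨ ∑-distrib-+ base (λ v → 60 * y₂ v) ⟨
          sum (y y₂ support′ Ny₂≤2)                                                    ∎

    quartic-packing : Packing 180 375
    quartic-packing = Assemble.packing R₅ (Stage₄.run (Stage₅.Result.ℓ′ R₅) (Stage₅.Result.dominated R₅))
      where
      R₅ : Stage₅.Result (λ _ → rest)
      R₅ = Stage₅.run (λ _ → rest) (λ _ ())

-- n ! times the n-th harmonic number.
harmonic : ℕ → ℕ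
harmonic zero    = 0
harmonic (suc n) = suc n * harmonic n + n !

-- The bound over the natural numbers, by maximum degree.

module Bounds (F : Graph) (k : ℕ) (w : Vertex F → ℕ) (k≤Nw : ∀ v → k ≤ Neighbourhoods.N F v w) where
  open Neighbourhoods F
  open MinimumCovers F
  open Greedy F

  packing⇒bound : ∀ A B n .{{_ : NonZero A}} → B * n ! ≡ A * harmonic n → Packing A B →
    n ! * (k * γ F) ≤ harmonic n * sum w
  packing⇒bound A B n ratio (y , Aγ≤ , Ny≤B) = *-cancelˡ-≤ A (begin
    A * (n ! * (k * γ F))      ≡⟨ swap A (n !) k (γ F) ⟩
    n ! * (k * (A * γ F))      ≤⟨ *-monoʳ-≤ (n !) (*-monoʳ-≤ k Aγ≤) ⟩
    n ! * (k * sum y)          ≤⟨ *-monoʳ-≤ (n !) (weak-duality k w k≤Nw y B Ny≤B) ⟩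
    n ! * (B * sum w)          ≡⟨ *-assoc (n !) B (sum w) ⟨
    n ! * B * sum w            ≡⟨ cong (_* sum w) (trans (*-comm (n !) B) ratio) ⟩
    A * harmonic n * sum w     ≡⟨ *-assoc A (harmonic n) (sum w) ⟩
    A * (harmonic n * sum w)   ∎)
    where
    open ≤-Reasoning
    swap : ∀ a f k g → a * (f * (k * g)) ≡ f * (k * (a * g))
    swap = solve-∀

  excess≡ : ∀ j → 6 * excess j + 7 * (3 + j) ! ≡ 6 * harmonic (3 + j)
  excess≡ zero    = refl
  excess≡ (suc j) = begin
    6 * excess (suc j) + 7 * (4 + j) !                                       ≡⟨ expand j ((3 + j) !) (excess j) ⟩
    6 * (3 + j) ! + (4 + j) * (6 * excess j + 7 * (3 + j) !)                 ≡⟨ cong (λ x → 6 * (3 + j) ! + (4 + j) * x) (excess≡ j) ⟩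
    6 * (3 + j) ! + (4 + j) * (6 * harmonic (3 + j))                         ≡⟨ contract j ((3 + j) !) (harmonic (3 + j)) ⟩
    6 * harmonic (4 + j)                                                     ∎
    where
    open ≡-Reasoning
    expand : ∀ j f x → 6 * (f + (4 + j) * x) + 7 * ((4 + j) * f) ≡ 6 * f + (4 + j) * (6 * x + 7 * f)
    expand = solve-∀
    contract : ∀ j f h → 6 * f + (4 + j) * (6 * h) ≡ 6 * ((4 + j) * h + f)
    contract = solve-∀

  -- Here Δ = 1+j. With k|V| ≤ (2+j) w(V), `chain` on all vertices gives the factor (2+j)/(3+j) +
  -- H(3+j) - 7/6 = H(Δ+1) - 1/6, and this is at most H(Δ) when 1/(Δ+1) ≤ 1/6.
  large : ∀ j → 4 ≤ j → maxDegree F ≡ suc j → suc j ! * (k * γ F) ≤ harmonic (suc j) * sum w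
  large j 4≤j Δ≡ with chain k w k≤Nw j (λ _ → true) (λ u → ≤-trans (∣N∣≤1+Δ u) (s≤s (≤-reflexive Δ≡)))
  ... | D , covered , D≤ = *-cancelˡ-≤ (6 * ((3 + j) * (2 + j))) (begin
    6 * ((3 + j) * (2 + j)) * (f * (k * γ F))                                ≤⟨ *-monoʳ-≤ (6 * ((3 + j) * (2 + j))) (*-monoʳ-≤ f (*-monoʳ-≤ k (γ≤length D (λ v → covered v refl)))) ⟩
    6 * ((3 + j) * (2 + j)) * (f * (k * length D))                           ≡⟨ assemble j f (k * length D) ⟩
    6 * ((3 + j) ! * (k * length D))                                         ≤⟨ *-monoʳ-≤ 6 D≤ ⟩
    6 * ((2 + j) ! * (k * sum (χ {Vertex F} (λ _ → true))) + x * W)          ≤⟨ *-monoʳ-≤ 6 (+-monoˡ-≤ (x * W) (*-monoʳ-≤ ((2 + j) !) n≤)) ⟩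
    6 * ((2 + j) ! * ((2 + j) * W) + x * W)                                  ≡⟨ collect ((2 + j) !) j x W ⟩
    -- Adding `7 * (3 + j) !` to both sides makes `excess≡` applicable without subtraction.
    (6 * ((2 + j) ! * (2 + j)) + 6 * x) * W                                  ≤⟨ *-monoˡ-≤ W (+-cancelʳ-≤ (7 * (3 + j) !) (6 * ((2 + j) ! * (2 + j)) + 6 * x) (6 * ((3 + j) * (2 + j)) * h) comparison) ⟩
    6 * ((3 + j) * (2 + j)) * h * W                                          ≡⟨ *-assoc (6 * ((3 + j) * (2 + j))) h W ⟩
    6 * ((3 + j) * (2 + j)) * (h * W)                                        ∎)
    where
    open ≤-Reasoning
    f = suc j !
    h = harmonic (suc j)
    x = excess j
    W = sum w
    n≤ : k * sum (χ {Vertex F} (λ _ → true)) ≤ (2 + j) * W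
    n≤ = weak-duality k w k≤Nw (λ _ → 1) (2 + j) (λ u → ≤-trans (∣N∣≤1+Δ u) (s≤s (≤-reflexive Δ≡)))
    assemble : ∀ j f m → 6 * ((3 + j) * (2 + j)) * (f * m) ≡ 6 * ((3 + j) * ((2 + j) * f) * m)
    assemble = solve-∀
    collect : ∀ g j x W → 6 * (g * ((2 + j) * W) + x * W) ≡ (6 * (g * (2 + j)) + 6 * x) * W
    collect = solve-∀
    expand : ∀ j f h → 6 * ((2 + j) * f * (2 + j)) + 6 * ((3 + j) * ((2 + j) * h + f) + (2 + j) * f)
                     ≡ 6 * ((3 + j) * (2 + j)) * h + f * (3 + j) * (6 * (3 + j))
    expand = solve-∀
    contract : ∀ j f → f * (3 + j) * (7 * (2 + j)) ≡ 7 * ((3 + j) * ((2 + j) * f))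
    contract = solve-∀
    -- This is 1 + 1/(Δ+1) ≤ 7/6 without denominators.
    ratio : 6 * (3 + j) ≤ 7 * (2 + j)
    ratio = begin
      6 * (3 + j)          ≡⟨ left j ⟩
      14 + 6 * j + 4       ≤⟨ +-monoʳ-≤ (14 + 6 * j) 4≤j ⟩
      14 + 6 * j + j       ≡⟨ right j ⟩
      7 * (2 + j)          ∎
      where
      left : ∀ j → 6 * (3 + j) ≡ 14 + 6 * j + 4
      left = solve-∀
      right : ∀ j → 14 + 6 * j + j ≡ 7 * (2 + j)
      right = solve-∀
    comparison : 6 * ((2 + j) ! * (2 + j)) + 6 * x + 7 * (3 + j) ! ≤ 6 * ((3 + j) * (2 + j)) * h + 7 * (3 + j) !
    comparison = begin
      6 * ((2 + j) ! * (2 + j)) + 6 * x + 7 * (3 + j) !             ≡⟨ +-assoc (6 * ((2 + j) ! * (2 + j))) (6 * x) (7 * (3 + j) !) ⟩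
      6 * ((2 + j) ! * (2 + j)) + (6 * x + 7 * (3 + j) !)           ≡⟨ cong (_+_ (6 * ((2 + j) ! * (2 + j)))) (excess≡ j) ⟩
      6 * ((2 + j) ! * (2 + j)) + 6 * harmonic (3 + j)              ≡⟨ expand j f h ⟩
      6 * ((3 + j) * (2 + j)) * h + f * (3 + j) * (6 * (3 + j))     ≤⟨ +-monoʳ-≤ (6 * ((3 + j) * (2 + j)) * h) (*-monoʳ-≤ (f * (3 + j)) ratio) ⟩
      6 * ((3 + j) * (2 + j)) * h + f * (3 + j) * (7 * (2 + j))     ≡⟨ cong (_+_ (6 * ((3 + j) * (2 + j)) * h)) (contract j f) ⟩
      6 * ((3 + j) * (2 + j)) * h + 7 * (3 + j) !                   ∎

  bound : ∀ n → maxDegree F ≡ n → n ≥ 1 → n ! * (k * γ F) ≤ harmonic n * sum w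
  bound n Δ≡ n≥1 with minCover (λ _ → true)
  ... | M with StarPartitions.starPartition F M
  ...   | A , isolated = go n Δ≡ n≥1
    where
    open StarPackings F M A isolated
    ore : ∀ {d} → maxDegree F ≡ d → d ≥ 1 → Packing 2 (suc d)
    ore refl = ore-packing
    go : ∀ n → maxDegree F ≡ n → n ≥ 1 → n ! * (k * γ F) ≤ harmonic n * sum w
    -- The ratios 2/2, 3/2, 22/12 and 375/180 are H(1), H(2), H(3) and H(4).
    go 1 Δ≡ n≥1 = packing⇒bound 2 2 1 refl (ore Δ≡ n≥1)
    go 2 Δ≡ n≥1 = packing⇒bound 2 3 2 refl (ore Δ≡ n≥1)
    go 3 Δ≡ _   = packing⇒bound 12 22 3 refl (Subcubic.subcubic-packing (≤-reflexive Δ≡))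
    go 4 Δ≡ _   = packing⇒bound 180 375 4 refl
      (Labelling.MaxDegree4.quartic-packing F (λ u → ≤-trans (∣N∣≤1+Δ u) (s≤s (≤-reflexive Δ≡))))
    go (suc j@(suc (suc (suc (suc _))))) Δ≡ _ = large j (s≤s (s≤s (s≤s (s≤s z≤n)))) Δ≡

-- Passage to the rational numbers.

fromℕ-homo-+ : ∀ a b → fromℕ (a + b) ≡ fromℕ a ℚ.+ fromℕ b
fromℕ-homo-+ a b = ℚ.toℚᵘ-injective (begin-equality
  ℚ.toℚᵘ (fromℕ (a + b))                          ≃⟨ ℚ.toℚᵘ-fromℚᵘ (ℚᵘ.mkℚᵘ (ℤ.+ (a + b)) 0) ⟩
  ℚᵘ.mkℚᵘ (ℤ.+ (a + b)) 0                           ≃⟨ ℚᵘ.*≡* (cong (ℤ._* ℤ.+ 1) (cong₂ ℤ._+_ (sym (ℤ.*-identityʳ (ℤ.+ a))) (sym (ℤ.*-identityʳ (ℤ.+ b))))) ⟩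
  ℚᵘ.mkℚᵘ (ℤ.+ a) 0 ℚᵘ.+ ℚᵘ.mkℚᵘ (ℤ.+ b) 0            ≃⟨ ℚᵘ.+-cong (ℚ.toℚᵘ-fromℚᵘ (ℚᵘ.mkℚᵘ (ℤ.+ a) 0)) (ℚ.toℚᵘ-fromℚᵘ (ℚᵘ.mkℚᵘ (ℤ.+ b) 0)) ⟨
  ℚ.toℚᵘ (fromℕ a) ℚᵘ.+ ℚ.toℚᵘ (fromℕ b)          ≃⟨ ℚ.toℚᵘ-homo-+ (fromℕ a) (fromℕ b) ⟨
  ℚ.toℚᵘ (fromℕ a ℚ.+ fromℕ b)                    ∎)
  where open ℚᵘ.≤-Reasoning

fromℕ-homo-* : ∀ a b → fromℕ (a * b) ≡ fromℕ a ℚ.* fromℕ b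
fromℕ-homo-* a b = ℚ.toℚᵘ-injective (begin-equality
  ℚ.toℚᵘ (fromℕ (a * b))                          ≃⟨ ℚ.toℚᵘ-fromℚᵘ (ℚᵘ.mkℚᵘ (ℤ.+ (a * b)) 0) ⟩
  ℚᵘ.mkℚᵘ (ℤ.+ (a * b)) 0                           ≃⟨ ℚᵘ.*≡* (cong (ℤ._* ℤ.+ 1) (ℤ.pos-* a b)) ⟩
  ℚᵘ.mkℚᵘ (ℤ.+ a) 0 ℚᵘ.* ℚᵘ.mkℚᵘ (ℤ.+ b) 0            ≃⟨ ℚᵘ.*-cong (ℚ.toℚᵘ-fromℚᵘ (ℚᵘ.mkℚᵘ (ℤ.+ a) 0)) (ℚ.toℚᵘ-fromℚᵘ (ℚᵘ.mkℚᵘ (ℤ.+ b) 0)) ⟨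
  ℚ.toℚᵘ (fromℕ a) ℚᵘ.* ℚ.toℚᵘ (fromℕ b)          ≃⟨ ℚ.toℚᵘ-homo-* (fromℕ a) (fromℕ b) ⟨
  ℚ.toℚᵘ (fromℕ a ℚ.* fromℕ b)                    ∎)
  where open ℚᵘ.≤-Reasoning

fromℕ-mono-≤ : ∀ {a b} → a ≤ b → fromℕ a ℚ.≤ fromℕ b
fromℕ-mono-≤ {a} {b} a≤b = ℚ.toℚᵘ-cancel-≤ (begin
  ℚ.toℚᵘ (fromℕ a)     ≃⟨ ℚ.toℚᵘ-fromℚᵘ (ℚᵘ.mkℚᵘ (ℤ.+ a) 0) ⟩
  ℚᵘ.mkℚᵘ (ℤ.+ a) 0      ≤⟨ ℚᵘ.*≤* (ℤ.*-monoʳ-≤-nonNeg (ℤ.+ 1) (ℤ.+≤+ a≤b)) ⟩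
  ℚᵘ.mkℚᵘ (ℤ.+ b) 0      ≃⟨ ℚ.toℚᵘ-fromℚᵘ (ℚᵘ.mkℚᵘ (ℤ.+ b) 0) ⟨
  ℚ.toℚᵘ (fromℕ b)     ∎)
  where open ℚᵘ.≤-Reasoning

fromℕ-suc-inverse : ∀ n → fromℕ (suc n) ℚ.* (ℤ.+ 1 ℚ./ suc n) ≡ 1ℚ
fromℕ-suc-inverse n = ℚ.toℚᵘ-injective (begin-equality
  ℚ.toℚᵘ (fromℕ (suc n) ℚ.* (ℤ.+ 1 ℚ./ suc n))               ≃⟨ ℚ.toℚᵘ-homo-* (fromℕ (suc n)) (ℤ.+ 1 ℚ./ suc n) ⟩
  ℚ.toℚᵘ (fromℕ (suc n)) ℚᵘ.* ℚ.toℚᵘ (ℤ.+ 1 ℚ./ suc n)       ≃⟨ ℚᵘ.*-cong (ℚ.toℚᵘ-fromℚᵘ (ℚᵘ.mkℚᵘ (ℤ.+ suc n) 0)) (ℚ.toℚᵘ-fromℚᵘ (ℚᵘ.mkℚᵘ (ℤ.+ 1) n)) ⟩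
  ℚᵘ.mkℚᵘ (ℤ.+ suc n) 0 ℚᵘ.* ℚᵘ.mkℚᵘ (ℤ.+ 1) n                 ≃⟨ ℚᵘ.*≡* (cong ℤ.+_ (rearrange n)) ⟩
  ℚ.toℚᵘ 1ℚ                                                ∎)
  where
  open ℚᵘ.≤-Reasoning
  rearrange : ∀ n → suc n * 1 * 1 ≡ 1 * (1 * suc n)
  rearrange = solve-∀

H-harmonic : ∀ n → fromℕ (n !) ℚ.* H n ≡ fromℕ (harmonic n)
H-harmonic zero    = refl
H-harmonic (suc n) = begin
  fromℕ (suc n * n !) ℚ.* (H n ℚ.+ r)                                       ≡⟨ ℚ.*-distribˡ-+ (fromℕ (suc n * n !)) (H n) r ⟩
  fromℕ (suc n * n !) ℚ.* H n ℚ.+ fromℕ (suc n * n !) ℚ.* r                 ≡⟨ cong₂ ℚ._+_ head-term last-term ⟩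
  fromℕ (suc n * harmonic n) ℚ.+ fromℕ (n !)                                ≡⟨ fromℕ-homo-+ (suc n * harmonic n) (n !) ⟨
  fromℕ (harmonic (suc n))                                                  ∎
  where
  open ≡-Reasoning
  r = ℤ.+ 1 ℚ./ suc n
  head-term : fromℕ (suc n * n !) ℚ.* H n ≡ fromℕ (suc n * harmonic n)
  head-term = begin
    fromℕ (suc n * n !) ℚ.* H n                  ≡⟨ cong (ℚ._* H n) (fromℕ-homo-* (suc n) (n !)) ⟩
    fromℕ (suc n) ℚ.* fromℕ (n !) ℚ.* H n        ≡⟨ ℚ.*-assoc (fromℕ (suc n)) (fromℕ (n !)) (H n) ⟩
    fromℕ (suc n) ℚ.* (fromℕ (n !) ℚ.* H n)      ≡⟨ cong (fromℕ (suc n) ℚ.*_) (H-harmonic n) ⟩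
    fromℕ (suc n) ℚ.* fromℕ (harmonic n)         ≡⟨ fromℕ-homo-* (suc n) (harmonic n) ⟨
    fromℕ (suc n * harmonic n)                   ∎
  last-term : fromℕ (suc n * n !) ℚ.* r ≡ fromℕ (n !)
  last-term = begin
    fromℕ (suc n * n !) ℚ.* r                    ≡⟨ cong (λ x → fromℕ x ℚ.* r) (*-comm (suc n) (n !)) ⟩
    fromℕ (n ! * suc n) ℚ.* r                    ≡⟨ cong (ℚ._* r) (fromℕ-homo-* (n !) (suc n)) ⟩
    fromℕ (n !) ℚ.* fromℕ (suc n) ℚ.* r          ≡⟨ ℚ.*-assoc (fromℕ (n !)) (fromℕ (suc n)) r ⟩
    fromℕ (n !) ℚ.* (fromℕ (suc n) ℚ.* r)        ≡⟨ cong (fromℕ (n !) ℚ.*_) (fromℕ-suc-inverse n) ⟩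
    fromℕ (n !) ℚ.* 1ℚ                           ≡⟨ ℚ.*-identityʳ (fromℕ (n !)) ⟩
    fromℕ (n !)                                  ∎

divide-by-H : ∀ {n} (n≥1 : n ≥ 1) a b W → n ! * (a * b) ≤ harmonic n * W →
  (1/ H n) {{H-nonZero n≥1}} ℚ.* fromℕ a ℚ.* fromℕ b ℚ.≤ fromℕ W
divide-by-H {n} n≥1 a b W bound = begin
  H⁻¹ ℚ.* fromℕ a ℚ.* fromℕ b      ≡⟨ ℚ.*-assoc H⁻¹ (fromℕ a) (fromℕ b) ⟩
  H⁻¹ ℚ.* (fromℕ a ℚ.* fromℕ b)    ≡⟨ cong (H⁻¹ ℚ.*_) (fromℕ-homo-* a b) ⟨
  H⁻¹ ℚ.* fromℕ (a * b)            ≤⟨ ℚ.*-monoˡ-≤-nonNeg H⁻¹ {{ℚ.pos⇒nonNeg H⁻¹ {{ℚ.1/pos⇒pos (H n) {{H-positive n≥1}}}}}} ab≤HW ⟩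
  H⁻¹ ℚ.* (H n ℚ.* fromℕ W)        ≡⟨ ℚ.*-assoc H⁻¹ (H n) (fromℕ W) ⟨
  H⁻¹ ℚ.* H n ℚ.* fromℕ W          ≡⟨ cong (ℚ._* fromℕ W) (ℚ.*-inverseˡ (H n)) ⟩
  1ℚ ℚ.* fromℕ W                   ≡⟨ ℚ.*-identityˡ (fromℕ W) ⟩
  fromℕ W                          ∎
  where
  open ℚ.≤-Reasoning
  instance
    H≢0 : ℚ.NonZero (H n)
    H≢0 = H-nonZero n≥1
    n!>0 : ℚ.Positive (fromℕ (n !))
    n!>0 = ℚ.normalize-pos (n !) 1 {{_}} {{n !≢0}}
  H⁻¹ = 1/ H n
  ab≤HW : fromℕ (a * b) ℚ.≤ H n ℚ.* fromℕ W
  ab≤HW = ℚ.*-cancelˡ-≤-pos (fromℕ (n !)) (begin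
    fromℕ (n !) ℚ.* fromℕ (a * b)            ≡⟨ fromℕ-homo-* (n !) (a * b) ⟨
    fromℕ (n ! * (a * b))                    ≤⟨ fromℕ-mono-≤ bound ⟩
    fromℕ (harmonic n * W)                   ≡⟨ fromℕ-homo-* (harmonic n) W ⟩
    fromℕ (harmonic n) ℚ.* fromℕ W           ≡⟨ cong (ℚ._* fromℕ W) (H-harmonic n) ⟨
    fromℕ (n !) ℚ.* H n ℚ.* fromℕ W          ≡⟨ ℚ.*-assoc (fromℕ (n !)) (H n) (fromℕ W) ⟩
    fromℕ (n !) ℚ.* (H n ℚ.* fromℕ W)        ∎)

theorem2p4 : (F G : Graph) (k : ℕ) (Δ≥1 : maxDegree F ≥ 1) →
    IsFoldCover G F k →
    fromℕ (γ G) ℚ.≥ (1/ H (maxDegree F)) {{H-nonZero Δ≥1}} ℚ.* fromℕ k ℚ.* fromℕ (γ F)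
theorem2p4 F G k Δ≥1 (π , covering , k-fold) =
  divide-by-H Δ≥1 k (γ F) (γ G) (scaled (proj₁ (γ-isLeast G)))
  where
  scaled : DominatingSize G (γ G) → maxDegree F ! * (k * γ F) ≤ harmonic (maxDegree F) * γ G
  scaled (S , dominating , ∣S∣≡γ) =
    subst (λ W → maxDegree F ! * (k * γ F) ≤ harmonic (maxDegree F) * W) (trans sum-weight ∣S∣≡γ)
      (Bounds.bound F k weight k≤N-weight (maxDegree F) refl Δ≥1)
    where
    open Projection covering k-fold S dominating
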